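{- Let $\rho$ be any positive integer. Every integer $n$ with $n\ge 550\rho^2$ is a sum of at most four squares of integers in $S_\rho$, i.e. there exist $k\le 4$ and $x_1,\dots,x_k\in S_\rho$ with $n=x_1^2+\cdots+x_k^2$.
   Context: For a positive integer $\rho$, $S_\rho=\{n\in\mathbb{Z} : n\ge 0,\ n\neq\rho\}$. -}

module Defs where

open import Data.Nat using (ℕ; _*_; _+_)
open import Data.List using (List; map)
open import Data.Nat.ListAction using (sum)
open import Relation.Binary.PropositionalEquality using (_≢_)

-- S ρ : membership predicate for S_ρ = { n ∈ ℤ : n ≥ 0, n ≠ ρ }.
-- Nonnegative integers are represented by ℕ.
S : ℕ → ℕ → Set
S ρ n = n ≢ ρ

sumSq : List ℕ → ℕ
sumSq xs = sum (map (λ x → x * x) xs)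

{-# OPTIONS --safe #-}
-- Take four squares with sum n (Lagrange). If v ∈ {0, ±1}⁴ has three nonzero entries and v · x = 3 q, the
-- reflection x - 2 q v is another integral vector of norm n, and which v are available depends only on
-- x mod 3. Suppose that x has first coordinate r = ± ρ and that the vectors reached by a few reflections all
-- have a coordinate ± ρ: each of them then gives a linear equation in the coordinates of x, with finitely many
-- choices of coefficients. Three independent equations make x an explicit multiple of r and force
-- n < 550 ρ²; a search over all choices, carried out by computation, shows that they always occur, once x
-- has two coordinates prime to 3 (which reflections achieve unless n is a square) and is not of the form
-- (r , r , r , d), where the residues of r and d modulo 27 say which reflections to use.
module Submission where

open import Defs

-- A mirror of norm 3 costs a single division by 3, so integrality is a condition on finitely many
-- residues and the search stays finite. On a branch with three independent equations the base
-- vector is proportional to their generalised cross product D, so n / r² = norm D / D₀² is one of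
-- finitely many rationals; 550 exceeds every ratio at which the search closes a branch by size.
--
-- Two obstacles shape the case analysis. If ± ρ is the only coordinate prime to 3, every usable
-- mirror has entry 0 there, so the reflection keeps ± ρ and only a trivial equation results; hence
-- the insistence on two coordinates prime to 3. If all four coordinates are 1 modulo 3, the usable
-- mirrors have three equal entries; on (r , r , r , d) the mirror (1 , 1 , 1 , 0) merely changes
-- the sign of r, and each of the other three fixes a coordinate r. There d stays free and n is
-- unbounded, so the search is restarted from other vectors, still written as linear forms in r and
-- d.

module Proof where
  open import Data.Bool using (Bool; true; false; if_then_else_; _∧_; _∨_; not; T)
  open import Data.Bool.ListAction using (any)
  open import Data.Bool.Properties using (T-∧; T-∨)
  open import Data.Empty using (⊥; ⊥-elim)
  open import Data.Fin using (Fin; toℕ; splitAt; join)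
  import Data.Fin.Properties as Fin
  open import Data.Integer
    using (ℤ; +_; -_; -[1+_]; _+_; _-_; _*_; _≤_; _<_; _≟_; _<?_; 0ℤ; 1ℤ; -1ℤ; ∣_∣; +≤+; +<+; NonZero;
      Positive; positive; NonNegative; nonNegative)
  open import Data.Integer.Divisibility.Signed using (_∣_; _∣?_; divides)
  open import Data.Integer.DivMod using (_%ℕ_; _/ℕ_; n%ℕd<d; a≡a%ℕn+[a/ℕn]*n)
  import Data.Integer.Properties as ℤ
  open import Data.Integer.Tactic.RingSolver using (solve-∀)
  open import Data.List
    using (List; []; _∷_; _++_; map; concatMap; filter; cartesianProductWith; cartesianProduct; length)
  open import Data.List.Membership.Propositional using (_∈_; lose)
  open import Data.List.Membership.Propositional.Properties
    using (∈-filter⁺; ∈-filter⁻; ∈-cartesianProduct⁺; ∈-cartesianProductWith⁺)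
  open import Data.List.Relation.Unary.All as All using (All; []; _∷_)
  import Data.List.Relation.Unary.All.Properties as All
  open import Data.List.Relation.Unary.Any as Any using (Any; here; there)
  import Data.List.Relation.Unary.Any.Properties as Any
  open import Data.Nat as ℕ using (ℕ; zero; suc; z≤n; s≤s)
  import Data.Nat.Divisibility as ℕ
  open import Data.Nat.DivMod using (_%_; _/_; _mod_; m≡m%n+[m/n]*n; m%n<n)
  open import Data.Nat.Induction using (<-rec)
  open import Data.Nat.ListAction using (product)
  open import Data.Nat.Primality using (Prime; prime⇒irreducible; prime⇒nonTrivial; prime⇒nonZero; euclidsLemma)
  open import Data.Nat.Primality.Factorisation using (PrimeFactorisation; factorise)
  import Data.Nat.Properties as ℕ
  open import Data.Product using (_,_; _×_; Σ-syntax; ∃-syntax; proj₁; proj₂)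
  open import Data.Sum as Sum using (_⊎_; inj₁; inj₂; [_,_]′)
  open import Function using (_∘_; case_of_; Equivalence)
  open import Relation.Binary.PropositionalEquality
  open import Relation.Nullary using (¬_; Dec; does; yes; no; contradiction)
  open import Relation.Nullary.Decidable using (from-yes)

  -- Vectors, linear forms and the search algorithm

  record Quad (A : Set) : Set where
    constructor ⟨_,_,_,_⟩
    field x₀ x₁ x₂ x₃ : A
  open Quad

  mapQ : ∀ {A B : Set} → (A → B) → Quad A → Quad B
  mapQ f ⟨ a , b , c , d ⟩ = ⟨ f a , f b , f c , f d ⟩

  zipQ : ∀ {A B C : Set} → (A → B → C) → Quad A → Quad B → Quad C
  zipQ f ⟨ a , b , c , d ⟩ ⟨ a′ , b′ , c′ , d′ ⟩ = ⟨ f a a′ , f b b′ , f c c′ , f d d′ ⟩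

  infixl 7 _·_ _•_
  infixl 6 _⊖_

  _·_ : Quad ℤ → Quad ℤ → ℤ
  ⟨ a , b , c , d ⟩ · ⟨ a′ , b′ , c′ , d′ ⟩ = a * a′ + b * b′ + c * c′ + d * d′

  norm : Quad ℤ → ℤ
  norm x = x · x

  _•_ : ℤ → Quad ℤ → Quad ℤ
  k • x = mapQ (k *_) x

  _⊖_ : Quad ℤ → Quad ℤ → Quad ℤ
  _⊖_ = zipQ _-_

  -- Linear forms in the coordinates of a fixed base vector, whose first coordinate is ± ρ.
  Form Matrix : Set
  Form = Quad ℤ
  Matrix = Quad Form

  identity : Matrix
  identity = ⟨ ⟨ 1ℤ , 0ℤ , 0ℤ , 0ℤ ⟩ , ⟨ 0ℤ , 1ℤ , 0ℤ , 0ℤ ⟩ , ⟨ 0ℤ , 0ℤ , 1ℤ , 0ℤ ⟩ , ⟨ 0ℤ , 0ℤ , 0ℤ , 1ℤ ⟩ ⟩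

  _ᵀ·_ : Quad ℤ → Matrix → Form
  v ᵀ· A = ⟨ v · mapQ x₀ A , v · mapQ x₁ A , v · mapQ x₂ A , v · mapQ x₃ A ⟩

  -- Clears the denominator in x - 2 (v · x / 3) v: with `s = v ᵀ· A` the new row represents 3 times
  -- the reflected coordinate, on top of the scale of `a`. Coefficients stay integral, and j
  -- reflections lead to the scale 3^j.
  reflectRow : Form → ℤ → Form → Form
  reflectRow s c a = + 3 • a ⊖ (+ 2 * c) • s

  reflectMatrix : Quad ℤ → Matrix → Matrix
  reflectMatrix v A = zipQ (reflectRow (v ᵀ· A)) v A

  residues : List ℤ
  residues = 0ℤ ∷ 1ℤ ∷ -1ℤ ∷ []

  residueVectors : List (Quad ℤ)
  residueVectors = cartesianProductWith (λ (a , b) (c , d) → ⟨ a , b , c , d ⟩)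
    (cartesianProduct residues residues) (cartesianProduct residues residues)

  -- One vector from each pair ± v, since both define the same reflection: 16 of the 32 candidates.
  mirrors : List (Quad ℤ)
  mirrors =
    ⟨ 0ℤ , 1ℤ , 1ℤ , 1ℤ ⟩ ∷
    ⟨ 0ℤ , 1ℤ , 1ℤ , -1ℤ ⟩ ∷
    ⟨ 0ℤ , 1ℤ , -1ℤ , 1ℤ ⟩ ∷
    ⟨ 0ℤ , 1ℤ , -1ℤ , -1ℤ ⟩ ∷
    ⟨ 1ℤ , 0ℤ , 1ℤ , 1ℤ ⟩ ∷
    ⟨ 1ℤ , 0ℤ , 1ℤ , -1ℤ ⟩ ∷
    ⟨ 1ℤ , 0ℤ , -1ℤ , 1ℤ ⟩ ∷
    ⟨ 1ℤ , 0ℤ , -1ℤ , -1ℤ ⟩ ∷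
    ⟨ 1ℤ , 1ℤ , 0ℤ , 1ℤ ⟩ ∷
    ⟨ 1ℤ , 1ℤ , 0ℤ , -1ℤ ⟩ ∷
    ⟨ 1ℤ , 1ℤ , 1ℤ , 0ℤ ⟩ ∷
    ⟨ 1ℤ , 1ℤ , -1ℤ , 0ℤ ⟩ ∷
    ⟨ 1ℤ , -1ℤ , 0ℤ , 1ℤ ⟩ ∷
    ⟨ 1ℤ , -1ℤ , 0ℤ , -1ℤ ⟩ ∷
    ⟨ 1ℤ , -1ℤ , 1ℤ , 0ℤ ⟩ ∷
    ⟨ 1ℤ , -1ℤ , -1ℤ , 0ℤ ⟩ ∷
    []

  minor : (a b c a′ b′ c′ a″ b″ c″ : ℤ) → ℤ
  minor a b c a′ b′ c′ a″ b″ c″ =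
    a * (b′ * c″ - c′ * b″) - b * (a′ * c″ - c′ * a″) + c * (a′ * b″ - b′ * a″)

  -- The generalised cross product in dimension four: `cross e f g · h` is the determinant with rows
  -- `h`, `e`, `f`, `g`. It is orthogonal to `e`, `f`, `g` and nonzero exactly when they are
  -- independent.
  cross : Form → Form → Form → Form
  cross ⟨ a , b , c , d ⟩ ⟨ a′ , b′ , c′ , d′ ⟩ ⟨ a″ , b″ , c″ , d″ ⟩ =
    ⟨ minor b c d b′ c′ d′ b″ c″ d″ , - minor a c d a′ c′ d′ a″ c″ d″
    , minor a b d a′ b′ d′ a″ b″ d″ , - minor a b c a′ b′ c′ a″ b″ c″ ⟩

  isZero : ℤ → Bool
  isZero z = does (z ≟ 0ℤ)

  -- A vector v annihilated by e, f, g satisfies D₀ v = v₀ D for D = cross e f g. So norm v < 550 v₀² or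
  -- v₀ = 0 if the first test succeeds, and v₀ = 0 if the second one does.
  small : Form → Bool
  small D = does (norm D <? + 550 * (x₀ D * x₀ D)) ∨ (isZero (x₀ D) ∧ not (isZero (norm D)))

  -- Forms vanishing at a base vector of norm at least 550 r², where r ≠ 0 is its first coordinate,
  -- never pass this test.
  closed : List Form → Bool
  closed (e ∷ f ∷ g ∷ []) = small (cross e f g)
  closed (h ∷ e ∷ f ∷ g ∷ []) = not (isZero (cross e f g · h))
  closed _ = false

  -- Discards options that carry no new information; nothing depends on its correctness.
  dependent : List Form → Form → Bool
  dependent [] e = isZero (norm e)
  dependent (f ∷ []) e = isZero (norm e * norm f - (e · f) * (e · f))
  dependent (f ∷ g ∷ []) e = isZero (norm (cross e f g))
  dependent (f ∷ g ∷ h ∷ []) e = isZero (cross f g h · e)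
  dependent _ _ = true

  -- Chooses one form from each list and abandons a branch at the first contradiction, so an empty
  -- result refutes every choice. A list is dropped once one of its forms depends on `es`: choosing
  -- that form would leave the system unchanged, so the list excludes nothing.
  expand : List Form → List (List Form) → List (List Form)
  expand es [] = if closed es then [] else es ∷ []
  expand es (o ∷ os) =
    if closed es then []
    else if any (dependent es) o then expand es os
    else concatMap (λ e → expand (e ∷ es) os) o

  -- The scaled coordinate k z = a · base of an image can be ± k r only if one of these forms vanishes.
  -- A coordinate fixed by the reflection (c = 0) is ruled out when its residue p is not ± that of r.
  coordinateOptions : (pᵣ k c p : ℤ) → Form → List Form
  coordinateOptions pᵣ k c p a =
    if isZero c ∧ not (does (+ 3 ∣? (p * p - pᵣ * pᵣ))) then []
    else a ⊖ ⟨ k , 0ℤ , 0ℤ , 0ℤ ⟩ ∷ a ⊖ ⟨ - k , 0ℤ , 0ℤ , 0ℤ ⟩ ∷ []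

  optionsAt : (pᵣ k : ℤ) → Matrix → Quad ℤ → Quad ℤ → (∀ {X : Set} → Quad X → X) → List Form
  optionsAt pᵣ k A p v π = coordinateOptions pᵣ (+ 3 * k) (π v) (π p) (reflectRow (v ᵀ· A) (π v) (π A))

  options : (pᵣ k : ℤ) → Matrix → Quad ℤ → Quad ℤ → List Form
  options pᵣ k A p v = optionsAt pᵣ k A p v x₀ ++ optionsAt pᵣ k A p v x₁
    ++ optionsAt pᵣ k A p v x₂ ++ optionsAt pᵣ k A p v x₃

  usable : Quad ℤ → List (Quad ℤ)
  usable p = filter (λ v → + 3 ∣? (v · p)) mirrors

  patterns : ℤ → List (Quad ℤ)
  patterns ν = filter (λ p → + 3 ∣? (norm p - ν)) residueVectors

  -- refine f k A es lists the systems of equations extending es that the base vector can satisfy if every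
  -- vector within f reflections of its image under A / k has a coordinate ± r. The norm is ν modulo 3, and r
  -- is pᵣ modulo 3.
  module _ (ν pᵣ : ℤ) where
    refine : ℕ → ℤ → Matrix → List Form → List (List Form)
    refineAt : ℕ → ℤ → Matrix → Quad ℤ → List Form → List (List Form)
    sweep : ℕ → ℤ → Matrix → List (Quad ℤ) → List (List Form) → List (List Form)
    refine zero k A es = es ∷ []
    refine (suc f) k A es = concatMap (λ p → refineAt f k A p es) (patterns ν)
    refineAt f k A p es = sweep f k A (usable p) (expand es (map (options pᵣ k A p) (usable p)))
    sweep f k A [] L = L
    sweep f k A (v ∷ vs) L = sweep f k A vs (concatMap (refine f (+ 3 * k) (reflectMatrix v A)) L)

  -- Residues and reflections modulo 3

  Representation : ℕ → ℕ → Set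
  Representation ρ n = Σ[ xs ∈ List ℕ ] (length xs ℕ.≤ 4 × All (S ρ) xs × n ≡ sumSq xs)

  0≤i*i : ∀ i → 0ℤ ≤ i * i
  0≤i*i (+ zero) = +≤+ z≤n
  0≤i*i (+ suc m) = +≤+ z≤n
  0≤i*i -[1+ m ] = +≤+ z≤n

  ∣i∣²≡i² : ∀ i → + (∣ i ∣ ℕ.* ∣ i ∣) ≡ i * i
  ∣i∣²≡i² i = trans (cong +_ (sym (ℤ.abs-* i i))) (ℤ.0≤i⇒+∣i∣≡i (0≤i*i i))

  toList : ∀ {A : Set} → Quad A → List A
  toList ⟨ a , b , c , d ⟩ = a ∷ b ∷ c ∷ d ∷ []

  avoids-or-hits : ∀ ρ n x → norm x ≡ + n →
    Representation ρ n ⊎ Any (λ z → ∣ z ∣ ≡ ρ) (toList x)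
  avoids-or-hits ρ n x@(⟨ a , b , c , d ⟩) eq with Any.any? (λ z → ∣ z ∣ ℕ.≟ ρ) (toList x)
  ... | yes hit = inj₂ hit
  ... | no ¬hit = inj₁ (map ∣_∣ (toList x) , s≤s (s≤s (s≤s (s≤s z≤n)))
                       , All.map⁺ (All.¬Any⇒All¬ _ ¬hit) , ℤ.+-injective (trans (sym eq) sum≡))
    where
    sq : ℕ → ℕ
    sq m = m ℕ.* m
    sum≡ : norm x ≡ + sumSq (map ∣_∣ (toList x))
    sum≡ rewrite sym (∣i∣²≡i² a) | sym (∣i∣²≡i² b) | sym (∣i∣²≡i² c) | sym (∣i∣²≡i² d) =
      cong +_ (trans (cong (λ s → A ℕ.+ B ℕ.+ C ℕ.+ s) (sym (ℕ.+-identityʳ D)))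
        (trans (ℕ.+-assoc (A ℕ.+ B) C _) (ℕ.+-assoc A B _)))
      where
      A = sq ∣ a ∣
      B = sq ∣ b ∣
      C = sq ∣ c ∣
      D = sq ∣ d ∣

  _≈_ : Quad ℤ → Quad ℤ → Set
  x ≈ p = ∃[ q ] x ≡ zipQ _+_ p (+ 3 • q)

  residue : ∀ z → ∃[ p ] (p ∈ residues × ∃[ q ] z ≡ p + + 3 * q)
  residue z with z %ℕ 3 | n%ℕd<d z 3 | a≡a%ℕn+[a/ℕn]*n z 3
  ... | 0 | _ | eq = 0ℤ , here refl , z /ℕ 3 , trans eq (cong (λ s → 0ℤ + s) (ℤ.*-comm (z /ℕ 3) (+ 3)))
  ... | 1 | _ | eq = 1ℤ , there (here refl) , z /ℕ 3 , trans eq (cong (λ s → 1ℤ + s) (ℤ.*-comm (z /ℕ 3) (+ 3)))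
  ... | 2 | _ | eq = -1ℤ , there (there (here refl)) , z /ℕ 3 + 1ℤ , trans eq (shift (z /ℕ 3))
    where
    shift : ∀ q → + 2 + q * + 3 ≡ -1ℤ + + 3 * (q + 1ℤ)
    shift = solve-∀
  ... | suc (suc (suc _)) | s≤s (s≤s (s≤s ())) | _

  residueVector : ∀ x → ∃[ p ] (p ∈ residueVectors × x ≈ p)
  residueVector ⟨ a , b , c , d ⟩ =
    let pa , a∈ , qa , a≡ = residue a
        pb , b∈ , qb , b≡ = residue b
        pc , c∈ , qc , c≡ = residue c
        pd , d∈ , qd , d≡ = residue d
    in ⟨ pa , pb , pc , pd ⟩
     , ∈-cartesianProductWith⁺ (λ (a , b) (c , d) → ⟨ a , b , c , d ⟩)
         (∈-cartesianProduct⁺ a∈ b∈) (∈-cartesianProduct⁺ c∈ d∈)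
     , ⟨ qa , qb , qc , qd ⟩
     , trans (cong₂ (λ a b → ⟨ a , b , c , d ⟩) a≡ b≡) (cong₂ (λ c d → ⟨ _ , _ , c , d ⟩) c≡ d≡)

  ·-≈ : ∀ v p q → v · zipQ _+_ p (+ 3 • q) ≡ v · p + + 3 * (v · q)
  ·-≈ ⟨ v₀ , v₁ , v₂ , v₃ ⟩ ⟨ p₀ , p₁ , p₂ , p₃ ⟩ ⟨ q₀ , q₁ , q₂ , q₃ ⟩ =
    identity′ v₀ v₁ v₂ v₃ p₀ p₁ p₂ p₃ q₀ q₁ q₂ q₃
    where
    identity′ : ∀ v₀ v₁ v₂ v₃ p₀ p₁ p₂ p₃ q₀ q₁ q₂ q₃ →
      v₀ * (p₀ + + 3 * q₀) + v₁ * (p₁ + + 3 * q₁) + v₂ * (p₂ + + 3 * q₂) + v₃ * (p₃ + + 3 * q₃)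
        ≡ v₀ * p₀ + v₁ * p₁ + v₂ * p₂ + v₃ * p₃ + + 3 * (v₀ * q₀ + v₁ * q₁ + v₂ * q₂ + v₃ * q₃)
    identity′ = solve-∀

  ·-comm : ∀ x y → x · y ≡ y · x
  ·-comm ⟨ a , b , c , d ⟩ ⟨ a′ , b′ , c′ , d′ ⟩ =
    cong₂ _+_ (cong₂ _+_ (cong₂ _+_ (ℤ.*-comm a a′) (ℤ.*-comm b b′)) (ℤ.*-comm c c′)) (ℤ.*-comm d d′)

  norm-≈ : ∀ p q → ∃[ t ] norm (zipQ _+_ p (+ 3 • q)) ≡ norm p + + 3 * t
  norm-≈ p q = (q · p + (p ⊞ q) · q) , (begin
    (p ⊞ q) · (p ⊞ q)                        ≡⟨ ·-≈ (p ⊞ q) p q ⟩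
    (p ⊞ q) · p + + 3 * ((p ⊞ q) · q)        ≡⟨ cong (λ s → s + + 3 * ((p ⊞ q) · q)) (·-comm (p ⊞ q) p) ⟩
    p · (p ⊞ q) + + 3 * ((p ⊞ q) · q)        ≡⟨ cong (λ s → s + + 3 * ((p ⊞ q) · q)) (·-≈ p p q) ⟩
    norm p + + 3 * (p · q) + + 3 * ((p ⊞ q) · q)
          ≡⟨ cong (λ s → norm p + + 3 * s + + 3 * ((p ⊞ q) · q)) (·-comm p q) ⟩
    norm p + + 3 * (q · p) + + 3 * ((p ⊞ q) · q) ≡⟨ collect (norm p) (q · p) ((p ⊞ q) · q) ⟩
    norm p + + 3 * (q · p + (p ⊞ q) · q)     ∎)
    where
    open ≡-Reasoning
    _⊞_ : Quad ℤ → Quad ℤ → Quad ℤ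
    p ⊞ q = zipQ _+_ p (+ 3 • q)
    collect : ∀ a b c → a + + 3 * b + + 3 * c ≡ a + + 3 * (b + c)
    collect = solve-∀

  patterns-complete : ∀ ν x → + 3 ∣ (norm x - ν) → ∃[ p ] (p ∈ patterns ν × x ≈ p)
  patterns-complete ν x (divides s eq) =
    let p , p∈ , q , x≡ = residueVector x
        t , norm≡ = norm-≈ p q
    in p , ∈-filter⁺ (λ p → + 3 ∣? (norm p - ν)) p∈
             (divides (s - t) (trans (isolate (norm p) ν (+ 3 * t))
               (trans (cong (λ m → m - ν - + 3 * t) (trans (sym norm≡) (cong norm (sym x≡))))
                 (trans (cong (_- + 3 * t) eq) (factor s t)))))
         , q , x≡
    where
    isolate : ∀ a ν t → a - ν ≡ a + t - ν - t
    isolate = solve-∀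
    factor : ∀ s t → s * + 3 - + 3 * t ≡ (s - t) * + 3
    factor = solve-∀

  mirror-norm : All (λ v → norm v ≡ + 3) mirrors
  mirror-norm = from-yes (All.all? (λ v → norm v ≟ + 3) mirrors)

  usable-divides : ∀ {x p v} → x ≈ p → v ∈ usable p → norm v ≡ + 3 × ∃[ q ] v · x ≡ + 3 * q
  usable-divides {x} {p} {v} (q , refl) v∈ with ∈-filter⁻ (λ v → + 3 ∣? (v · p)) {xs = mirrors} v∈
  ... | v∈mirrors , divides t eq = All.lookup mirror-norm v∈mirrors , t + v · q , (begin
    v · zipQ _+_ p (+ 3 • q)  ≡⟨ ·-≈ v p q ⟩
    v · p + + 3 * (v · q)     ≡⟨ cong (λ s → s + + 3 * (v · q)) eq ⟩
    t * + 3 + + 3 * (v · q)   ≡⟨ factor t (v · q) ⟩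
    + 3 * (t + v · q)         ∎)
    where
    open ≡-Reasoning
    factor : ∀ t u → t * + 3 + + 3 * u ≡ + 3 * (t + u)
    factor = solve-∀

  reflectVector : Quad ℤ → ℤ → Quad ℤ → Quad ℤ
  reflectVector v q x = x ⊖ (+ 2 * q) • v

  norm-reflect : ∀ v q x → norm v ≡ + 3 → v · x ≡ + 3 * q → norm (reflectVector v q x) ≡ norm x
  norm-reflect v@(⟨ v₀ , v₁ , v₂ , v₃ ⟩) q x@(⟨ a , b , c , d ⟩) norm≡ v·x≡ = begin
    norm (reflectVector v q x)
      ≡⟨ expanded v₀ v₁ v₂ v₃ q a b c d ⟩
    norm x - + 4 * q * (v · x) + + 4 * (q * q) * norm v
      ≡⟨ cong₂ (λ s t → norm x - + 4 * q * s + + 4 * (q * q) * t) v·x≡ norm≡ ⟩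
    norm x - + 4 * q * (+ 3 * q) + + 4 * (q * q) * + 3
      ≡⟨ cancel (norm x) q ⟩
    norm x ∎
    where
    open ≡-Reasoning
    expanded : ∀ v₀ v₁ v₂ v₃ q a b c d →
      (a - + 2 * q * v₀) * (a - + 2 * q * v₀) + (b - + 2 * q * v₁) * (b - + 2 * q * v₁)
        + (c - + 2 * q * v₂) * (c - + 2 * q * v₂) + (d - + 2 * q * v₃) * (d - + 2 * q * v₃)
      ≡ a * a + b * b + c * c + d * d - + 4 * q * (v₀ * a + v₁ * b + v₂ * c + v₃ * d)
        + + 4 * (q * q) * (v₀ * v₀ + v₁ * v₁ + v₂ * v₂ + v₃ * v₃)
    expanded = solve-∀
    cancel : ∀ m q → m - + 4 * q * (+ 3 * q) + + 4 * (q * q) * + 3 ≡ m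
    cancel = solve-∀

  ᵀ·-assoc : ∀ v A x → (v ᵀ· A) · x ≡ v · mapQ (_· x) A
  ᵀ·-assoc ⟨ v₀ , v₁ , v₂ , v₃ ⟩
    ⟨ ⟨ a₀ , a₁ , a₂ , a₃ ⟩ , ⟨ b₀ , b₁ , b₂ , b₃ ⟩ , ⟨ c₀ , c₁ , c₂ , c₃ ⟩ , ⟨ d₀ , d₁ , d₂ , d₃ ⟩ ⟩
    ⟨ x₀ , x₁ , x₂ , x₃ ⟩ =
    swap v₀ v₁ v₂ v₃ a₀ a₁ a₂ a₃ b₀ b₁ b₂ b₃ c₀ c₁ c₂ c₃ d₀ d₁ d₂ d₃ x₀ x₁ x₂ x₃
    where
    swap : ∀ v₀ v₁ v₂ v₃ a₀ a₁ a₂ a₃ b₀ b₁ b₂ b₃ c₀ c₁ c₂ c₃ d₀ d₁ d₂ d₃ x₀ x₁ x₂ x₃ →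
      (v₀ * a₀ + v₁ * b₀ + v₂ * c₀ + v₃ * d₀) * x₀ + (v₀ * a₁ + v₁ * b₁ + v₂ * c₁ + v₃ * d₁) * x₁
        + (v₀ * a₂ + v₁ * b₂ + v₂ * c₂ + v₃ * d₂) * x₂ + (v₀ * a₃ + v₁ * b₃ + v₂ * c₃ + v₃ * d₃) * x₃
      ≡ v₀ * (a₀ * x₀ + a₁ * x₁ + a₂ * x₂ + a₃ * x₃) + v₁ * (b₀ * x₀ + b₁ * x₁ + b₂ * x₂ + b₃ * x₃)
        + v₂ * (c₀ * x₀ + c₁ * x₁ + c₂ * x₂ + c₃ * x₃) + v₃ * (d₀ * x₀ + d₁ * x₁ + d₂ * x₂ + d₃ * x₃)
    swap = solve-∀

  •-· : ∀ k v x → v · (k • x) ≡ k * (v · x)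
  •-· k ⟨ v₀ , v₁ , v₂ , v₃ ⟩ ⟨ a , b , c , d ⟩ = factor k v₀ v₁ v₂ v₃ a b c d
    where
    factor : ∀ k v₀ v₁ v₂ v₃ a b c d → v₀ * (k * a) + v₁ * (k * b) + v₂ * (k * c) + v₃ * (k * d)
      ≡ k * (v₀ * a + v₁ * b + v₂ * c + v₃ * d)
    factor = solve-∀

  reflectRow-· : ∀ s c a x → reflectRow s c a · x ≡ + 3 * (a · x) - + 2 * c * (s · x)
  reflectRow-· ⟨ s₀ , s₁ , s₂ , s₃ ⟩ c ⟨ a₀ , a₁ , a₂ , a₃ ⟩ ⟨ x₀ , x₁ , x₂ , x₃ ⟩ =
    linear s₀ s₁ s₂ s₃ c a₀ a₁ a₂ a₃ x₀ x₁ x₂ x₃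
    where
    linear : ∀ s₀ s₁ s₂ s₃ c a₀ a₁ a₂ a₃ x₀ x₁ x₂ x₃ →
      (+ 3 * a₀ - + 2 * c * s₀) * x₀ + (+ 3 * a₁ - + 2 * c * s₁) * x₁
        + (+ 3 * a₂ - + 2 * c * s₂) * x₂ + (+ 3 * a₃ - + 2 * c * s₃) * x₃
      ≡ + 3 * (a₀ * x₀ + a₁ * x₁ + a₂ * x₂ + a₃ * x₃) - + 2 * c * (s₀ * x₀ + s₁ * x₁ + s₂ * x₂ + s₃ * x₃)
    linear = solve-∀

  -- Soundness of the search

  square-injective : ∀ i j → i * i ≡ j * j → i ≡ j ⊎ i ≡ - j
  square-injective i j eq with ℤ.i*j≡0⇒i≡0∨j≡0 (i - j) {i + j}
        (trans (factor i j) (trans (cong (_- j * j) eq) (ℤ.+-inverseʳ (j * j))))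
    where
    factor : ∀ i j → (i - j) * (i + j) ≡ i * i - j * j
    factor = solve-∀
  ... | inj₁ i-j≡0 = inj₁ (ℤ.i-j≡0⇒i≡j i j i-j≡0)
  ... | inj₂ i+j≡0 = inj₂ (trans (sym (cancel i j)) (trans (cong (_- j) i+j≡0) (ℤ.+-identityˡ (- j))))
    where
    cancel : ∀ i j → i + j - j ≡ i
    cancel = solve-∀

  ∣i∣≡∣j∣⇒i≡±j : ∀ i j → ∣ i ∣ ≡ ∣ j ∣ → i ≡ j ⊎ i ≡ - j
  ∣i∣≡∣j∣⇒i≡±j i j eq = square-injective i j
    (trans (sym (∣i∣²≡i² i)) (trans (cong (λ m → + (m ℕ.* m)) eq) (∣i∣²≡i² j)))

  module _ {e f g v : Quad ℤ} (e·v≡0 : e · v ≡ 0ℤ) (f·v≡0 : f · v ≡ 0ℤ) (g·v≡0 : g · v ≡ 0ℤ) where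
    private
      D = cross e f g

      vanish : ∀ l m n → l * (e · v) + m * (f · v) + n * (g · v) ≡ 0ℤ
      vanish l m n rewrite e·v≡0 | f·v≡0 | g·v≡0 = zeros l m n
        where
        zeros : ∀ l m n → l * 0ℤ + m * 0ℤ + n * 0ℤ ≡ 0ℤ
        zeros = solve-∀

      open Quad e renaming (x₀ to e₀; x₁ to e₁; x₂ to e₂; x₃ to e₃)
      open Quad f renaming (x₀ to f₀; x₁ to f₁; x₂ to f₂; x₃ to f₃)
      open Quad g renaming (x₀ to g₀; x₁ to g₁; x₂ to g₂; x₃ to g₃)
      open Quad v renaming (x₀ to v₀; x₁ to v₁; x₂ to v₂; x₃ to v₃)

      -- Combining the three equations with 2×2 minors as coefficients eliminates two of v₁, v₂, v₃.
      eliminate₁ : ∀ e₀ e₁ e₂ e₃ f₀ f₁ f₂ f₃ g₀ g₁ g₂ g₃ v₀ v₁ v₂ v₃ →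
        (e₁ * (f₂ * g₃ - f₃ * g₂) - e₂ * (f₁ * g₃ - f₃ * g₁) + e₃ * (f₁ * g₂ - f₂ * g₁)) * v₁
          - (- (e₀ * (f₂ * g₃ - f₃ * g₂) - e₂ * (f₀ * g₃ - f₃ * g₀) + e₃ * (f₀ * g₂ - f₂ * g₀))) * v₀
        ≡ (f₂ * g₃ - f₃ * g₂) * (e₀ * v₀ + e₁ * v₁ + e₂ * v₂ + e₃ * v₃)
          + (e₃ * g₂ - e₂ * g₃) * (f₀ * v₀ + f₁ * v₁ + f₂ * v₂ + f₃ * v₃)
          + (e₂ * f₃ - e₃ * f₂) * (g₀ * v₀ + g₁ * v₁ + g₂ * v₂ + g₃ * v₃)
      eliminate₁ = solve-∀

      eliminate₂ : ∀ e₀ e₁ e₂ e₃ f₀ f₁ f₂ f₃ g₀ g₁ g₂ g₃ v₀ v₁ v₂ v₃ →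
        (e₁ * (f₂ * g₃ - f₃ * g₂) - e₂ * (f₁ * g₃ - f₃ * g₁) + e₃ * (f₁ * g₂ - f₂ * g₁)) * v₂
          - (e₀ * (f₁ * g₃ - f₃ * g₁) - e₁ * (f₀ * g₃ - f₃ * g₀) + e₃ * (f₀ * g₁ - f₁ * g₀)) * v₀
        ≡ (f₃ * g₁ - f₁ * g₃) * (e₀ * v₀ + e₁ * v₁ + e₂ * v₂ + e₃ * v₃)
          + (e₁ * g₃ - e₃ * g₁) * (f₀ * v₀ + f₁ * v₁ + f₂ * v₂ + f₃ * v₃)
          + (e₃ * f₁ - e₁ * f₃) * (g₀ * v₀ + g₁ * v₁ + g₂ * v₂ + g₃ * v₃)
      eliminate₂ = solve-∀

      eliminate₃ : ∀ e₀ e₁ e₂ e₃ f₀ f₁ f₂ f₃ g₀ g₁ g₂ g₃ v₀ v₁ v₂ v₃ →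
        (e₁ * (f₂ * g₃ - f₃ * g₂) - e₂ * (f₁ * g₃ - f₃ * g₁) + e₃ * (f₁ * g₂ - f₂ * g₁)) * v₃
          - (- (e₀ * (f₁ * g₂ - f₂ * g₁) - e₁ * (f₀ * g₂ - f₂ * g₀) + e₂ * (f₀ * g₁ - f₁ * g₀))) * v₀
        ≡ (f₁ * g₂ - f₂ * g₁) * (e₀ * v₀ + e₁ * v₁ + e₂ * v₂ + e₃ * v₃)
          + (e₂ * g₁ - e₁ * g₂) * (f₀ * v₀ + f₁ * v₁ + f₂ * v₂ + f₃ * v₃)
          + (e₁ * f₂ - e₂ * f₁) * (g₀ * v₀ + g₁ * v₁ + g₂ * v₂ + g₃ * v₃)
      eliminate₃ = solve-∀

    cramer₁ : x₀ D * v₁ ≡ x₁ D * v₀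
    cramer₁ = ℤ.i-j≡0⇒i≡j _ _ (trans (eliminate₁ e₀ e₁ e₂ e₃ f₀ f₁ f₂ f₃ g₀ g₁ g₂ g₃ v₀ v₁ v₂ v₃)
      (vanish (f₂ * g₃ - f₃ * g₂) (e₃ * g₂ - e₂ * g₃) (e₂ * f₃ - e₃ * f₂)))

    cramer₂ : x₀ D * v₂ ≡ x₂ D * v₀
    cramer₂ = ℤ.i-j≡0⇒i≡j _ _ (trans (eliminate₂ e₀ e₁ e₂ e₃ f₀ f₁ f₂ f₃ g₀ g₁ g₂ g₃ v₀ v₁ v₂ v₃)
      (vanish (f₃ * g₁ - f₁ * g₃) (e₁ * g₃ - e₃ * g₁) (e₃ * f₁ - e₁ * f₃)))

    cramer₃ : x₀ D * v₃ ≡ x₃ D * v₀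
    cramer₃ = ℤ.i-j≡0⇒i≡j _ _ (trans (eliminate₃ e₀ e₁ e₂ e₃ f₀ f₁ f₂ f₃ g₀ g₁ g₂ g₃ v₀ v₁ v₂ v₃)
      (vanish (f₁ * g₂ - f₂ * g₁) (e₂ * g₁ - e₁ * g₂) (e₁ * f₂ - e₂ * f₁)))

  -- The hypotheses amount to D₀ v = v₀ D, here paired with `h`. The choices h = v and h = D
  -- together give D₀² norm v = v₀² norm D; a fourth form vanishing at `v` forces D · h = 0 when v₀
  -- is nonzero.
  proportional-· : ∀ h D v → x₀ D * x₁ v ≡ x₁ D * x₀ v → x₀ D * x₂ v ≡ x₂ D * x₀ v →
    x₀ D * x₃ v ≡ x₃ D * x₀ v → x₀ D * (h · v) ≡ (D · h) * x₀ v
  proportional-· ⟨ h₀ , h₁ , h₂ , h₃ ⟩ ⟨ d₀ , d₁ , d₂ , d₃ ⟩ ⟨ r , b , c , d ⟩ eb ec ed =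
    trans (distribute d₀ h₀ h₁ h₂ h₃ r b c d)
      (trans (cong₂ (λ s t → h₀ * (d₀ * r) + h₁ * s + h₂ * t + h₃ * (d₀ * d)) eb ec)
        (trans (cong (λ s → h₀ * (d₀ * r) + h₁ * (d₁ * r) + h₂ * (d₂ * r) + h₃ * s) ed)
          (collect d₀ d₁ d₂ d₃ h₀ h₁ h₂ h₃ r)))
    where
    distribute : ∀ d₀ h₀ h₁ h₂ h₃ r b c d → d₀ * (h₀ * r + h₁ * b + h₂ * c + h₃ * d)
      ≡ h₀ * (d₀ * r) + h₁ * (d₀ * b) + h₂ * (d₀ * c) + h₃ * (d₀ * d)
    distribute = solve-∀
    collect : ∀ d₀ d₁ d₂ d₃ h₀ h₁ h₂ h₃ r →
      h₀ * (d₀ * r) + h₁ * (d₁ * r) + h₂ * (d₂ * r) + h₃ * (d₃ * r)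
      ≡ (d₀ * h₀ + d₁ * h₁ + d₂ * h₂ + d₃ * h₃) * r
    collect = solve-∀

  any-++₄ : ∀ {X : Set} {P : X → Set} {ws xs ys zs : List X} →
    Any P ws ⊎ Any P xs ⊎ Any P ys ⊎ Any P zs → Any P (ws ++ xs ++ ys ++ zs)
  any-++₄ (inj₁ w) = Any.++⁺ˡ w
  any-++₄ {ws = ws} (inj₂ (inj₁ x)) = Any.++⁺ʳ ws (Any.++⁺ˡ x)
  any-++₄ {ws = ws} {xs} (inj₂ (inj₂ (inj₁ y))) = Any.++⁺ʳ ws (Any.++⁺ʳ xs (Any.++⁺ˡ y))
  any-++₄ {ws = ws} {xs} {ys} (inj₂ (inj₂ (inj₂ z))) = Any.++⁺ʳ ws (Any.++⁺ʳ xs (Any.++⁺ʳ ys z))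

  does-true : ∀ {P : Set} (p : Dec P) → T (does p) → P
  does-true (yes p) _ = p

  not-does-true : ∀ {P : Set} (p : Dec P) → T (not (does p)) → ¬ P
  not-does-true (no ¬p) _ = ¬p

  module Search
    (ρ n : ℕ) (base : Quad ℤ)
    (∣r∣≡ρ : ∣ x₀ base ∣ ≡ ρ) (r≢0 : x₀ base ≢ 0ℤ)
    (norm-base : norm base ≡ + n) (large : + 550 * (x₀ base * x₀ base) ≤ norm base)
    (ν : ℤ) (n≡ν : + 3 ∣ (+ n - ν))
    (pᵣ : ℤ) (r≡pᵣ : ∃[ s ] x₀ base ≡ pᵣ + + 3 * s)
    where

    private
      r = x₀ base

    Vanishes : Form → Set
    Vanishes e = e · base ≡ 0ℤ

    -- From D₀² norm base = r² norm D, a ratio below 550 contradicts `large`. If D₀ = 0, the same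
    -- proportionality paired with D gives r norm D = 0, although both factors are nonzero.
    not-small : ∀ {e f g} → Vanishes e → Vanishes f → Vanishes g → ¬ T (small (cross e f g))
    not-small {e} {f} {g} ve vf vg t = case Equivalence.to T-∨ t of λ where
        (inj₁ norm<) → ℤ.<-irrefl refl (ℤ.<-≤-trans (below (does-true (norm D <? + 550 * (D₀ * D₀)) norm<)) above)
        (inj₂ degenerate) → case Equivalence.to T-∧ degenerate of λ (D₀≡0 , norm≢0) →
          case ℤ.i*j≡0⇒i≡0∨j≡0 (norm D) {r}
                (trans (sym (proportional D)) (trans (cong (_* (D · base)) (does-true (D₀ ≟ 0ℤ) D₀≡0))
                      (ℤ.*-zeroˡ (D · base)))) of λ where
            (inj₁ norm≡0) → not-does-true (norm D ≟ 0ℤ) norm≢0 norm≡0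
            (inj₂ r≡0) → r≢0 r≡0
      where
      D = cross e f g
      D₀ = x₀ D

      proportional : ∀ h → D₀ * (h · base) ≡ (D · h) * r
      proportional h = proportional-· h D base
        (cramer₁ {e} {f} {g} {base} ve vf vg) (cramer₂ {e} {f} {g} {base} ve vf vg)
              (cramer₃ {e} {f} {g} {base} ve vf vg)

      instance
        r²-positive : Positive (r * r)
        r²-positive = positive (ℤ.≤∧≢⇒< (0≤i*i r) (λ 0≡r² → [ r≢0 , r≢0 ]′ (ℤ.i*j≡0⇒i≡0∨j≡0 r (sym 0≡r²))))

      D₀²-nonNegative : NonNegative (D₀ * D₀)
      D₀²-nonNegative = nonNegative (0≤i*i D₀)

      D₀²norm : D₀ * D₀ * norm base ≡ norm D * (r * r)
      D₀²norm = begin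
        D₀ * D₀ * norm base      ≡⟨ ℤ.*-assoc D₀ D₀ (norm base) ⟩
        D₀ * (D₀ * norm base)    ≡⟨ cong (D₀ *_) (proportional base) ⟩
        D₀ * ((D · base) * r)    ≡⟨ sym (ℤ.*-assoc D₀ (D · base) r) ⟩
        D₀ * (D · base) * r      ≡⟨ cong (_* r) (proportional D) ⟩
        norm D * r * r           ≡⟨ ℤ.*-assoc (norm D) r r ⟩
        norm D * (r * r)         ∎
        where open ≡-Reasoning

      below : norm D < + 550 * (D₀ * D₀) → norm D * (r * r) < + 550 * (D₀ * D₀) * (r * r)
      below = ℤ.*-monoʳ-<-pos (r * r)

      above : + 550 * (D₀ * D₀) * (r * r) ≤ norm D * (r * r)
      above = subst₂ _≤_ (swap (D₀ * D₀) (r * r)) D₀²norm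
        (ℤ.*-monoˡ-≤-nonNeg (D₀ * D₀) {{D₀²-nonNegative}} large)
        where
        swap : ∀ a b → a * (+ 550 * b) ≡ + 550 * a * b
        swap = solve-∀

    not-closed : ∀ {es} → All Vanishes es → ¬ T (closed es)
    not-closed {e ∷ f ∷ g ∷ []} (ve ∷ vf ∷ vg ∷ []) = not-small {e} {f} {g} ve vf vg
    not-closed {h ∷ e ∷ f ∷ g ∷ []} (vh ∷ ve ∷ vf ∷ vg ∷ []) t =
      case ℤ.i*j≡0⇒i≡0∨j≡0 (D · h) {r} (trans (sym (proportional-· h D base
        (cramer₁ {e} {f} {g} {base} ve vf vg) (cramer₂ {e} {f} {g} {base} ve vf vg)
              (cramer₃ {e} {f} {g} {base} ve vf vg)))
        (trans (cong (x₀ D *_) vh) (ℤ.*-zeroʳ (x₀ D)))) of λ where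
        (inj₁ D·h≡0) → not-does-true (D · h ≟ 0ℤ) t D·h≡0
        (inj₂ r≡0) → r≢0 r≡0
      where D = cross e f g

    expand-sound : ∀ es os → All Vanishes es → All (Any Vanishes) os → Any (All Vanishes) (expand es os)
    expand-sound es [] ves [] with closed es in eq
    ... | true = ⊥-elim (not-closed ves (subst T (sym eq) _))
    ... | false = here ves
    expand-sound es (o ∷ os) ves (vo ∷ vos) with closed es in eq
    ... | true = ⊥-elim (not-closed ves (subst T (sym eq) _))
    ... | false with any (dependent es) o
    ... | true = expand-sound es os ves vos
    ... | false = Any.concatMap⁺ (λ e → expand (e ∷ es) os)
                    (Any.map (λ {e} ve → expand-sound (e ∷ es) os (ve ∷ ves) vos) vo)

    -- The integral vector is kept beside its matrix, because the values of `A` at `base` are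
    -- divisible by `k` only for suitable residues of `base`.
    record Image (k : ℤ) (A : Matrix) : Set where
      constructor image
      field
        vector : Quad ℤ
        norm≡  : norm vector ≡ + n
        linear : k • vector ≡ mapQ (_· base) A
    open Image

    -- `k` times v · x is the form `v ᵀ· A` at `base`, so the factor 3 k turns the quotient `q` into
    -- a linear form.
    reflectLinear : ∀ {k A} (x : Image k A) v q → v · vector x ≡ + 3 * q →
      ∀ x₀ a v₀ → k * x₀ ≡ a · base →
      + 3 * k * (x₀ - + 2 * q * v₀) ≡ reflectRow (v ᵀ· A) v₀ a · base
    reflectLinear {k} {A} x v q v·x≡ x₀ a v₀ row = begin
      + 3 * k * (x₀ - + 2 * q * v₀)                ≡⟨ rearrange k x₀ q v₀ ⟩
      + 3 * (k * x₀) - + 2 * v₀ * (k * (+ 3 * q))  ≡⟨ cong₂ (λ s t → + 3 * s - + 2 * v₀ * t) row s·base ⟩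
      + 3 * (a · base) - + 2 * v₀ * ((v ᵀ· A) · base) ≡⟨ sym (reflectRow-· (v ᵀ· A) v₀ a base) ⟩
      reflectRow (v ᵀ· A) v₀ a · base              ∎
      where
      open ≡-Reasoning
      rearrange : ∀ k x q c → + 3 * k * (x - + 2 * q * c) ≡ + 3 * (k * x) - + 2 * c * (k * (+ 3 * q))
      rearrange = solve-∀
      s·base : k * (+ 3 * q) ≡ (v ᵀ· A) · base
      s·base = trans (cong (k *_) (sym v·x≡)) (trans (sym (•-· k v (vector x)))
        (trans (cong (v ·_) (linear x)) (sym (ᵀ·-assoc v A base))))

    reflect : ∀ {k A} (x : Image k A) v q → norm v ≡ + 3 → v · vector x ≡ + 3 * q →
      Image (+ 3 * k) (reflectMatrix v A)
    reflect {k} {A} x v q norm-v v·x≡ = image (reflectVector v q (vector x))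
      (trans (norm-reflect v q (vector x) norm-v v·x≡) (norm≡ x))
      (cong₂ (λ (a , b) (c , d) → ⟨ a , b , c , d ⟩)
        (cong₂ _,_ (row x₀ (cong x₀ (linear x))) (row x₁ (cong x₁ (linear x))))
        (cong₂ _,_ (row x₂ (cong x₂ (linear x))) (row x₃ (cong x₃ (linear x)))))
      where
      row : (π : ∀ {A : Set} → Quad A → A) → k * π (vector x) ≡ π A · base →
        + 3 * k * (π (vector x) - + 2 * q * π v) ≡ reflectRow (v ᵀ· A) (π v) (π A) · base
      row π = reflectLinear x v q v·x≡ (π (vector x)) (π A) (π v)

    hit-vanishes : ∀ k a z → k * z ≡ a · base → ∣ z ∣ ≡ ρ →
      Any Vanishes (a ⊖ ⟨ k , 0ℤ , 0ℤ , 0ℤ ⟩ ∷ a ⊖ ⟨ - k , 0ℤ , 0ℤ , 0ℤ ⟩ ∷ [])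
    hit-vanishes k a z kz≡ hit = case ∣i∣≡∣j∣⇒i≡±j z r (trans hit (sym ∣r∣≡ρ)) of λ where
        (inj₁ z≡r) → here (trans (subtract a k base) (ℤ.i≡j⇒i-j≡0 (trans (sym kz≡) (cong (k *_) z≡r))))
        (inj₂ z≡-r) → there (here (trans (subtract a (- k) base) (ℤ.i≡j⇒i-j≡0
          (trans (sym kz≡) (trans (cong (k *_) z≡-r) (negate k r))))))
      where
      negate : ∀ k r → k * (- r) ≡ - k * r
      negate = solve-∀
      subtract : ∀ a k x → (a ⊖ ⟨ k , 0ℤ , 0ℤ , 0ℤ ⟩) · x ≡ a · x - k * x₀ x
      subtract ⟨ a₀ , a₁ , a₂ , a₃ ⟩ k ⟨ y₀ , y₁ , y₂ , y₃ ⟩ = linear′ a₀ a₁ a₂ a₃ k y₀ y₁ y₂ y₃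
        where
        linear′ : ∀ a₀ a₁ a₂ a₃ k y₀ y₁ y₂ y₃ →
          (a₀ - k) * y₀ + (a₁ - 0ℤ) * y₁ + (a₂ - 0ℤ) * y₂ + (a₃ - 0ℤ) * y₃
          ≡ a₀ * y₀ + a₁ * y₁ + a₂ * y₂ + a₃ * y₃ - k * y₀
        linear′ = solve-∀

    coordinateOptions-sound : ∀ k c p q′ a q x → x ≡ p + + 3 * q′ →
      k * (x - + 2 * q * c) ≡ a · base → ∣ x - + 2 * q * c ∣ ≡ ρ →
      Any Vanishes (coordinateOptions pᵣ k c p a)
    coordinateOptions-sound k c p q′ a q x x≡ row hit
      with isZero c ∧ not (does (+ 3 ∣? (p * p - pᵣ * pᵣ))) in excluded
    ... | false = hit-vanishes k a (x - + 2 * q * c) row hit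
    -- An unmoved coordinate equal to ± r has the square of r, in particular modulo 3, so a
    -- discarded option cannot occur.
    ... | true = let c≡0 , ¬div = Equivalence.to T-∧ (subst T (sym excluded) _) in
        ⊥-elim (not-does-true (+ 3 ∣? (p * p - pᵣ * pᵣ)) ¬div (p²≡r² (does-true (c ≟ 0ℤ) c≡0)))
      where
      s = proj₁ r≡pᵣ
      complete : ∀ p q r s → p * p - r * r ≡ (p + + 3 * q) * (p + + 3 * q) - (r + + 3 * s) * (r + + 3 * s)
        + (+ 2 * r * s + + 3 * (s * s) - + 2 * p * q - + 3 * (q * q)) * + 3
      complete = solve-∀
      fixed : ∀ x q → x - + 2 * q * 0ℤ ≡ x
      fixed = solve-∀
      t = + 2 * pᵣ * s + + 3 * (s * s) - + 2 * p * q′ - + 3 * (q′ * q′)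
      p²≡r² : c ≡ 0ℤ → + 3 ∣ (p * p - pᵣ * pᵣ)
      p²≡r² refl = divides t (trans (complete p q′ pᵣ s)
        (trans (cong (λ u → u + t * + 3)
              (trans (cong₂ (λ x r → x * x - r * r) (sym x≡) (sym (proj₂ r≡pᵣ))) x²-r²≡0))
          (ℤ.+-identityˡ (t * + 3))))
        where
        x²-r²≡0 : x * x - r * r ≡ 0ℤ
        x²-r²≡0 = ℤ.i≡j⇒i-j≡0 (trans (sym (∣i∣²≡i² x)) (trans (cong (λ m → + (m ℕ.* m))
          (trans (trans (cong ∣_∣ (sym (fixed x q))) hit) (sym ∣r∣≡ρ))) (∣i∣²≡i² r)))

    -- The dichotomy that drives the search: the reflected vector either avoids ρ and is the
    -- representation sought, or its coordinate ± r supplies an equation for `base`.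
    options-sound : ∀ {k A} (x : Image k A) p v q → vector x ≈ p → norm v ≡ + 3 → v · vector x ≡ + 3 * q →
      Representation ρ n ⊎ Any Vanishes (options pᵣ k A p v)
    options-sound {k} {A} x p v q (q′ , x≡) norm-v v·x≡ =
      Sum.map₂ located (avoids-or-hits ρ n (vector (reflect x v q norm-v v·x≡))
            (norm≡ (reflect x v q norm-v v·x≡)))
      where
      o : (∀ {X : Set} → Quad X → X) → List Form
      o = optionsAt pᵣ k A p v
      sound : (π : ∀ {X : Set} → Quad X → X) → π (vector x) ≡ π p + + 3 * π q′ →
        k * π (vector x) ≡ π A · base → ∣ π (vector x) - + 2 * q * π v ∣ ≡ ρ → Any Vanishes (o π)
      sound π x≡ row = coordinateOptions-sound (+ 3 * k) (π v) (π p) (π q′) (reflectRow (v ᵀ· A) (π v) (π A)) q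
        (π (vector x)) x≡ (reflectLinear x v q v·x≡ (π (vector x)) (π A) (π v) row)
      located : Any (λ z → ∣ z ∣ ≡ ρ) (toList (reflectVector v q (vector x))) → Any Vanishes (options pᵣ k A p v)
      located (here h) = any-++₄ {ws = o x₀} {o x₁} {o x₂} {o x₃}
        (inj₁ (sound x₀ (cong x₀ x≡) (cong x₀ (linear x)) h))
      located (there (here h)) = any-++₄ {ws = o x₀} {o x₁} {o x₂} {o x₃}
        (inj₂ (inj₁ (sound x₁ (cong x₁ x≡) (cong x₁ (linear x)) h)))
      located (there (there (here h))) = any-++₄ {ws = o x₀} {o x₁} {o x₂} {o x₃}
        (inj₂ (inj₂ (inj₁ (sound x₂ (cong x₂ x≡) (cong x₂ (linear x)) h))))
      located (there (there (there (here h)))) = any-++₄ {ws = o x₀} {o x₁} {o x₂} {o x₃}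
        (inj₂ (inj₂ (inj₂ (sound x₃ (cong x₃ x≡) (cong x₃ (linear x)) h))))

    private
      any⊎ : ∀ {X : Set} {P Q : X → Set} {R : Set} {xs} → (∀ a → P a → R ⊎ Q a) → Any P xs → R ⊎ Any Q xs
      any⊎ f (here {x} p) = [ inj₁ , inj₂ ∘ here ]′ (f x p)
      any⊎ f (there ps) = [ inj₁ , inj₂ ∘ there ]′ (any⊎ f ps)

      all⊎ : ∀ {X : Set} {Q : X → Set} {R : Set} xs → (∀ {a} → a ∈ xs → R ⊎ Q a) → R ⊎ All Q xs
      all⊎ [] f = inj₂ []
      all⊎ (x ∷ xs) f with f (here refl) | all⊎ xs (f ∘ there)
      ... | inj₁ r | _ = inj₁ r
      ... | inj₂ _ | inj₁ r = inj₁ r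
      ... | inj₂ q | inj₂ qs = inj₂ (q ∷ qs)

    Outcome : List (List Form) → Set
    Outcome L = Representation ρ n ⊎ Any (All Vanishes) L

    -- Any vector met on the way that avoids ρ ends the argument through the left alternative.
    -- Otherwise each reflection contributes an equation true at `base`, and the system of true
    -- equations survives in the list.
    refine-sound : ∀ f {k A} → Image k A → ∀ es → All Vanishes es → Outcome (refine ν pᵣ f k A es)
    refineAt-sound : ∀ f {k A} (x : Image k A) p → vector x ≈ p → ∀ es → All Vanishes es →
      Outcome (refineAt ν pᵣ f k A p es)
    sweep-sound : ∀ f {k A} (x : Image k A) vs →
      (∀ {v} → v ∈ vs → norm v ≡ + 3 × ∃[ q ] v · vector x ≡ + 3 * q) →
      ∀ L → Any (All Vanishes) L → Outcome (sweep ν pᵣ f k A vs L)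

    refine-sound zero x es ves = inj₂ (here ves)
    refine-sound (suc f) {k} {A} x es ves =
      -- The residues of an image depend on `base` modulo a higher power of 3. Only its norm is
      -- known modulo 3, so the search ran over all patterns of that norm, and the actual one is
      -- selected here.
      let p , p∈ , x≈p = patterns-complete ν (vector x) (subst (λ m → + 3 ∣ (m - ν)) (sym (norm≡ x)) n≡ν)
      in [ inj₁ , (λ leaf → inj₂ (Any.concatMap⁺ (λ p → refineAt ν pᵣ f k A p es) (lose p∈ leaf))) ]′
           (refineAt-sound f x p x≈p es ves)

    refineAt-sound f {k} {A} x p x≈p es ves =
      [ inj₁ , (λ vos → sweep-sound f x (usable p) (usable-divides {vector x} {p} x≈p) _
                          (expand-sound es (map (options pᵣ k A p) (usable p)) ves (All.map⁺ vos))) ]′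
        (all⊎ {Q = λ v → Any Vanishes (options pᵣ k A p v)} (usable p)
          (λ {v} v∈ → let norm-v , q , v·x≡ = usable-divides {vector x} {p} x≈p v∈
                      in options-sound x p v q x≈p norm-v v·x≡))

    sweep-sound f x [] _ L leaf = inj₂ leaf
    sweep-sound f {k} {A} x (v ∷ vs) ok L leaf =
      let norm-v , q , v·x≡ = ok (here refl) in
      [ inj₁ , (λ leaves → sweep-sound f x vs (ok ∘ there) _
                 (Any.concatMap⁺ (refine ν pᵣ f (+ 3 * k) (reflectMatrix v A)) leaves)) ]′
        (any⊎ {Q = λ es → Any (All Vanishes) (refine ν pᵣ f (+ 3 * k) (reflectMatrix v A) es)}
          (refine-sound f (reflect x v q norm-v v·x≡)) leaf)

  -- Representations with unit coordinates modulo 3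

  -- There is no case for -1: changing the sign of a coordinate affects neither the norm nor the
  -- absolute values that must avoid ρ.
  data Residue : ℤ → Set where
    multiple : ∀ q → Residue (+ 3 * q)
    unit     : ∀ q → Residue (1ℤ + + 3 * q)

  normalise : ∀ z → ∃[ z′ ] (∣ z′ ∣ ≡ ∣ z ∣ × Residue z′)
  normalise z with residue z
  ... | _ , here refl , q , refl = + 3 * q , cong ∣_∣ (sym (ℤ.+-identityˡ (+ 3 * q))) , multiple q
  ... | _ , there (here refl) , q , refl = 1ℤ + + 3 * q , refl , unit q
  ... | _ , there (there (here refl)) , q , refl =
    1ℤ + + 3 * (- q) , trans (cong ∣_∣ (negate q)) (ℤ.∣-i∣≡∣i∣ (-1ℤ + + 3 * q)) , unit (- q)
    where
    negate : ∀ q → 1ℤ + + 3 * (- q) ≡ - (-1ℤ + + 3 * q)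
    negate = solve-∀

  ∣i∣≡∣j∣⇒i²≡j² : ∀ {i j} → ∣ i ∣ ≡ ∣ j ∣ → i * i ≡ j * j
  ∣i∣≡∣j∣⇒i²≡j² {i} {j} eq = trans (sym (∣i∣²≡i² i)) (trans (cong (λ m → + (m ℕ.* m)) eq) (∣i∣²≡i² j))

  sumSq₃ : ℤ → ℤ → ℤ → ℤ
  sumSq₃ b c d = b * b + c * c + d * d

  normalise₃ : ∀ b c d → ∃[ b′ ] ∃[ c′ ] ∃[ d′ ]
    (Residue b′ × Residue c′ × Residue d′ × sumSq₃ b′ c′ d′ ≡ sumSq₃ b c d)
  normalise₃ b c d =
    let b′ , ∣b∣ , rb = normalise b
        c′ , ∣c∣ , rc = normalise c
        d′ , ∣d∣ , rd = normalise d
    in b′ , c′ , d′ , rb , rc , rd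
     , cong₂ _+_ (cong₂ _+_ (∣i∣≡∣j∣⇒i²≡j² {b′} {b} ∣b∣) (∣i∣≡∣j∣⇒i²≡j² {c′} {c} ∣c∣))
           (∣i∣≡∣j∣⇒i²≡j² {d′} {d} ∣d∣)

  swap₁₂ : ∀ x y z → x + y + z ≡ y + x + z
  swap₁₂ = solve-∀

  swap₂₃ : ∀ x y z → x + y + z ≡ x + z + y
  swap₂₃ = solve-∀

  Primitive : ℤ → Set
  Primitive m = ∃[ q ] ∃[ c ] ∃[ d ] sumSq₃ (1ℤ + + 3 * q) c d ≡ m

  -- A vector (u , c , d) with u ≢ 0 mod 3 has nonzero inner product mod 3 with some w = (1 , ±1 , ±1);
  -- the reflection of 3 (u , c , d) in w is then no longer divisible by 3.
  unit-multiple : ∀ q c d i j → (1ℤ + + 3 * i) * (1ℤ + + 3 * i) ≡ c * c → + 3 * j * (+ 3 * j) ≡ d * d →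
    Primitive (+ 9 * sumSq₃ (1ℤ + + 3 * q) c d)
  unit-multiple q c d i j c² d² =
    + 2 * i + + 2 * j - q , 1ℤ + + 3 * i - + 2 * (1ℤ + + 3 * q) - + 6 * j
    , + 3 * j - + 2 * (1ℤ + + 3 * q) - + 2 * (1ℤ + + 3 * i)
    , trans (reflected q i j) (cong₂ (λ s t → + 9 * ((1ℤ + + 3 * q) * (1ℤ + + 3 * q) + s + t)) c² d²)
    where
    reflected : ∀ q i j →
      (1ℤ + + 3 * (+ 2 * i + + 2 * j - q)) * (1ℤ + + 3 * (+ 2 * i + + 2 * j - q))
        + (1ℤ + + 3 * i - + 2 * (1ℤ + + 3 * q) - + 6 * j) * (1ℤ + + 3 * i - + 2 * (1ℤ + + 3 * q) - + 6 * j)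
        + (+ 3 * j - + 2 * (1ℤ + + 3 * q) - + 2 * (1ℤ + + 3 * i)) *
              (+ 3 * j - + 2 * (1ℤ + + 3 * q) - + 2 * (1ℤ + + 3 * i))
      ≡ + 9 * ((1ℤ + + 3 * q) * (1ℤ + + 3 * q) + (1ℤ + + 3 * i) * (1ℤ + + 3 * i) + + 3 * j * (+ 3 * j))
    reflected = solve-∀

  primitive-*9 : ∀ {m} → Primitive m → Primitive (+ 9 * m)
  primitive-*9 (q , c , d , refl) with normalise c | normalise d
  ... | _ , ∣c∣ , multiple i | _ , ∣d∣ , multiple j =
    q - + 2 * i - + 2 * j , + 3 * i - + 2 * (1ℤ + + 3 * q) - + 6 * j , + 3 * j - + 2 * (1ℤ + + 3 * q) - + 6 * i
    , trans (reflected q i j)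
        (cong₂ (λ s t → + 9 * ((1ℤ + + 3 * q) * (1ℤ + + 3 * q) + s + t))
          (∣i∣≡∣j∣⇒i²≡j² {+ 3 * i} {c} ∣c∣) (∣i∣≡∣j∣⇒i²≡j² {+ 3 * j} {d} ∣d∣))
    where
    reflected : ∀ q i j →
      (1ℤ + + 3 * (q - + 2 * i - + 2 * j)) * (1ℤ + + 3 * (q - + 2 * i - + 2 * j))
        + (+ 3 * i - + 2 * (1ℤ + + 3 * q) - + 6 * j) * (+ 3 * i - + 2 * (1ℤ + + 3 * q) - + 6 * j)
        + (+ 3 * j - + 2 * (1ℤ + + 3 * q) - + 6 * i) * (+ 3 * j - + 2 * (1ℤ + + 3 * q) - + 6 * i)
      ≡ + 9 * ((1ℤ + + 3 * q) * (1ℤ + + 3 * q) + + 3 * i * (+ 3 * i) + + 3 * j * (+ 3 * j))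
    reflected = solve-∀
  ... | _ , ∣c∣ , unit i | _ , ∣d∣ , multiple j = unit-multiple q c d i j
          (∣i∣≡∣j∣⇒i²≡j² {1ℤ + + 3 * i} {c} ∣c∣) (∣i∣≡∣j∣⇒i²≡j² {+ 3 * j} {d} ∣d∣)
  ... | _ , ∣c∣ , multiple j | _ , ∣d∣ , unit i =
        let q′ , c′ , d′ , eq = unit-multiple q d c i j (∣i∣≡∣j∣⇒i²≡j² {1ℤ + + 3 * i} {d} ∣d∣)
                  (∣i∣≡∣j∣⇒i²≡j² {+ 3 * j} {c} ∣c∣)
        in q′ , c′ , d′ , trans eq (cong (+ 9 *_) (swap₂₃ ((1ℤ + + 3 * q) * (1ℤ + + 3 * q)) (d * d) (c * c)))
  ... | _ , ∣c∣ , unit i | _ , ∣d∣ , unit j =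
    -- The mirror (1 , 1 , 1) would have inner product 0 modulo 3 with three coordinates 1, so (1 ,
    -- 1 , -1) replaces it.
    q - + 2 * i + + 2 * j , 1ℤ + + 3 * i - + 2 * (1ℤ + + 3 * q) + + 2 * (1ℤ + + 3 * j)
    , 1ℤ + + 3 * j + + 2 * (1ℤ + + 3 * q) + + 2 * (1ℤ + + 3 * i)
    , trans (reflected q i j)
        (cong₂ (λ s t → + 9 * ((1ℤ + + 3 * q) * (1ℤ + + 3 * q) + s + t))
          (∣i∣≡∣j∣⇒i²≡j² {1ℤ + + 3 * i} {c} ∣c∣) (∣i∣≡∣j∣⇒i²≡j² {1ℤ + + 3 * j} {d} ∣d∣))
    where
    reflected : ∀ q i j →
      (1ℤ + + 3 * (q - + 2 * i + + 2 * j)) * (1ℤ + + 3 * (q - + 2 * i + + 2 * j))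
        + (1ℤ + + 3 * i - + 2 * (1ℤ + + 3 * q) + + 2 * (1ℤ + + 3 * j)) *
              (1ℤ + + 3 * i - + 2 * (1ℤ + + 3 * q) + + 2 * (1ℤ + + 3 * j))
        + (1ℤ + + 3 * j + + 2 * (1ℤ + + 3 * q) + + 2 * (1ℤ + + 3 * i)) *
              (1ℤ + + 3 * j + + 2 * (1ℤ + + 3 * q) + + 2 * (1ℤ + + 3 * i))
      ≡ + 9 * ((1ℤ + + 3 * q) * (1ℤ + + 3 * q) + (1ℤ + + 3 * i) * (1ℤ + + 3 * i) + (1ℤ + + 3 * j) *
            (1ℤ + + 3 * j))
    reflected = solve-∀

  -- If no coordinate is prime to 3, the sum is 9 times a smaller nonzero sum of three squares;
  -- `primitive-*9` lifts a primitive representation of that one.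
  primitive-sum : ∀ m → m ≢ 0 → ∀ b c d → sumSq₃ b c d ≡ + m → Primitive (+ m)
  primitive-sum = <-rec (λ m → m ≢ 0 → ∀ b c d → sumSq₃ b c d ≡ + m → Primitive (+ m)) step
    where
    step : ∀ m → (∀ {k} → k ℕ.< m → k ≢ 0 → ∀ b c d → sumSq₃ b c d ≡ + k → Primitive (+ k)) →
      m ≢ 0 → ∀ b c d → sumSq₃ b c d ≡ + m → Primitive (+ m)
    step m rec m≢0 b c d eq with normalise₃ b c d
    ... | _ , c′ , d′ , unit q , _ , _ , eq′ = q , c′ , d′ , trans eq′ eq
    ... | b′ , _ , d′ , _ , unit q , _ , eq′ = q , b′ , d′ , trans
          (swap₁₂ ((1ℤ + + 3 * q) * (1ℤ + + 3 * q)) (b′ * b′) (d′ * d′)) (trans eq′ eq)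
    ... | b′ , c′ , _ , _ , _ , unit q , eq′ = q , b′ , c′ , trans
          (rotate ((1ℤ + + 3 * q) * (1ℤ + + 3 * q)) (b′ * b′) (c′ * c′)) (trans eq′ eq)
      where
      rotate : ∀ x y z → x + y + z ≡ y + z + x
      rotate = solve-∀
    ... | _ , _ , _ , multiple i , multiple j , multiple k , eq′ =
      subst Primitive (sym m≡9*k) (primitive-*9 (subst Primitive sum≡ (rec smaller nonzero i j k (sym sum≡))))
      where
      thrice : ∀ i j k → + 3 * i * (+ 3 * i) + + 3 * j * (+ 3 * j) + + 3 * k * (+ 3 * k) ≡ + 9 *
            (i * i + j * j + k * k)
      thrice = solve-∀
      s = ∣ sumSq₃ i j k ∣
      sum≡ : + s ≡ sumSq₃ i j k
      sum≡ = ℤ.0≤i⇒+∣i∣≡i (ℤ.+-mono-≤ (ℤ.+-mono-≤ (0≤i*i i) (0≤i*i j)) (0≤i*i k))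
      m≡9*k : + m ≡ + 9 * sumSq₃ i j k
      m≡9*k = trans (sym eq) (trans (sym eq′) (thrice i j k))
      m≡9*s : m ≡ 9 ℕ.* s
      m≡9*s = ℤ.+-injective (trans m≡9*k (trans (cong (+ 9 *_) (sym sum≡)) (sym (ℤ.pos-* 9 s))))
      nonzero : s ≢ 0
      nonzero s≡0 = m≢0 (trans m≡9*s (cong (9 ℕ.*_) s≡0))
      smaller : s ℕ.< m
      smaller = subst (s ℕ.<_) (sym m≡9*s) (ℕ.m<m+n s (ℕ.≤-trans (ℕ.n≢0⇒n>0 nonzero) (ℕ.m≤m+n s (7 ℕ.* s))))

  -- Representations avoiding ρ

  quad≡ : ∀ {A : Set} {a b c d a′ b′ c′ d′ : A} → a ≡ a′ → b ≡ b′ → c ≡ c′ → d ≡ d′ →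
    ⟨ a , b , c , d ⟩ ≡ ⟨ a′ , b′ , c′ , d′ ⟩
  quad≡ refl refl refl refl = refl

  -- `f` counts the reflections allowed beyond the first. Normalising the left side is the search
  -- itself, so a proof by `refl` makes the type checker run it.
  Closes : ℕ → Quad ℤ → Set
  Closes f p = refineAt (norm p) (x₀ p) f 1ℤ identity p [] ≡ []

  -- The subscripts are the residues modulo 3 of the coordinates, with ± ρ in first place.
  closes₁₁₀₀ : Closes 0 ⟨ 1ℤ , 1ℤ , 0ℤ , 0ℤ ⟩
  closes₁₁₀₀ = refl

  closes₀₀₁₁ : Closes 1 ⟨ 0ℤ , 0ℤ , 1ℤ , 1ℤ ⟩
  closes₀₀₁₁ = refl

  closes₁₁₁₀ : Closes 1 ⟨ 1ℤ , 1ℤ , 1ℤ , 0ℤ ⟩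
  closes₁₁₁₀ = refl

  closes₀₁₁₁ : Closes 0 ⟨ 0ℤ , 1ℤ , 1ℤ , 1ℤ ⟩
  closes₀₁₁₁ = refl

  second≡first third≡first : Form
  second≡first = ⟨ - + 3 , + 3 , 0ℤ , 0ℤ ⟩
  third≡first = ⟨ - + 3 , 0ℤ , + 3 , 0ℤ ⟩

  -- What single reflections leave undecided. Every system says that two of the last three
  -- coordinates equal the first: 4 r - 2 c - 2 d = 0, for instance, becomes d = r once c = r.
  leaves : List (List Form)
  leaves =
    (third≡first ∷ ⟨ + 4 , 0ℤ , - + 2 , - + 2 ⟩ ∷ []) ∷
    (⟨ + 4 , - + 2 , 0ℤ , - + 2 ⟩ ∷ second≡first ∷ []) ∷
    (⟨ + 1 , + 1 , 0ℤ , - + 2 ⟩ ∷ second≡first ∷ []) ∷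
    (third≡first ∷ second≡first ∷ []) ∷
    (⟨ + 1 , - + 2 , 0ℤ , + 1 ⟩ ∷ second≡first ∷ []) ∷
    (third≡first ∷ ⟨ + 1 , 0ℤ , + 1 , - + 2 ⟩ ∷ []) ∷
    (third≡first ∷ ⟨ + 1 , 0ℤ , - + 2 , + 1 ⟩ ∷ []) ∷ []

  leaves₁₁₁₁ : refineAt (+ 4) 1ℤ 0 1ℤ identity ⟨ 1ℤ , 1ℤ , 1ℤ , 1ℤ ⟩ [] ≡ leaves
  leaves₁₁₁₁ = refl

  twoEqual : List Form
  twoEqual = second≡first ∷ third≡first ∷ []

  -- 3 or 9 times the vectors reached from (r , r , r , d) by one or two reflections.
  image₃ image₉ image₉′ : Matrix
  image₃ = ⟨ ⟨ + 3 , 0ℤ , 0ℤ , 0ℤ ⟩ , ⟨ 1ℤ , 0ℤ , 0ℤ , + 2 ⟩ , ⟨ 1ℤ , 0ℤ , 0ℤ , + 2 ⟩ , ⟨ - + 4 , 0ℤ , 0ℤ , 1ℤ ⟩ ⟩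
  image₉ = ⟨ ⟨ + 9 , 0ℤ , 0ℤ , 0ℤ ⟩ , ⟨ + 5 , 0ℤ , 0ℤ , - + 8 ⟩ ,
             ⟨ - + 11 , 0ℤ , 0ℤ , - + 4 ⟩ , ⟨ - + 4 , 0ℤ , 0ℤ , 1ℤ ⟩ ⟩
  image₉′ = ⟨ ⟨ + 9 , 0ℤ , 0ℤ , 0ℤ ⟩ , ⟨ - + 7 , 0ℤ , 0ℤ , + 4 ⟩ , ⟨ - + 7 , 0ℤ , 0ℤ , + 4 ⟩ ,
              ⟨ - + 8 , 0ℤ , 0ℤ , - + 7 ⟩ ⟩

  -- Starting from the two equations of the family (r , r , r , d), one further independent equation
  -- determines d as a multiple of r.
  ClosesTwoEqual : ℤ → Matrix → Quad ℤ → Set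
  ClosesTwoEqual k A p = refineAt (norm p) 1ℤ 0 k A p twoEqual ≡ []

  norm-swap₀₁ : ∀ a b c d → norm ⟨ a , b , c , d ⟩ ≡ norm ⟨ b , a , c , d ⟩
  norm-swap₀₁ a b c d = swap (a * a) (b * b) (c * c) (d * d)
    where
    swap : ∀ a b c d → a + b + c + d ≡ b + a + c + d
    swap = solve-∀

  norm-swap₂₃ : ∀ a b c d → norm ⟨ a , b , c , d ⟩ ≡ norm ⟨ a , b , d , c ⟩
  norm-swap₂₃ a b c d = swap (a * a) (b * b) (c * c) (d * d)
    where
    swap : ∀ a b c d → a + b + c + d ≡ a + b + d + c
    swap = solve-∀

  norm-front : ∀ c a b d → norm ⟨ c , a , b , d ⟩ ≡ norm ⟨ a , b , c , d ⟩
  norm-front c a b d = rotate (c * c) (a * a) (b * b) (d * d)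
    where
    rotate : ∀ c a b d → c + a + b + d ≡ a + b + c + d
    rotate = solve-∀

  norm-rotate : ∀ a d b c → norm ⟨ a , d , b , c ⟩ ≡ norm ⟨ a , b , c , d ⟩
  norm-rotate a d b c = rotate (a * a) (d * d) (b * b) (c * c)
    where
    rotate : ∀ a d b c → a + d + b + c ≡ a + b + c + d
    rotate = solve-∀

  module Finish (ρ n : ℕ) (1≤ρ : 1 ℕ.≤ ρ) (n-large : n ℕ.≥ 550 ℕ.* (ρ ℕ.* ρ)) where

    -- The starting vector `x` may differ from `base`: for (r , r , r , d) it is an image under one
    -- or two reflections, and the equations found still concern `base`.
    search : ∀ base → ∣ x₀ base ∣ ≡ ρ → norm base ≡ + n → ∀ pᵣ → (∃[ s ] x₀ base ≡ pᵣ + + 3 * s) →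
      ∀ f k A p x → x ≈ p → norm x ≡ + n → k • x ≡ mapQ (_· base) A →
      ∀ es → All (λ e → e · base ≡ 0ℤ) es →
      Representation ρ n ⊎ Any (All (λ e → e · base ≡ 0ℤ)) (refineAt (norm p) pᵣ f k A p es)
    search base hit norm-base pᵣ r≡pᵣ f k A p x x≈p norm-x linear =
      S.refineAt-sound f (S.image x norm-x linear) p x≈p
      where
      r = x₀ base
      r≢0 : r ≢ 0ℤ
      r≢0 r≡0 = case trans (sym hit) (cong ∣_∣ r≡0) of λ ρ≡0 → ℕ.<-irrefl (sym ρ≡0) 1≤ρ
      large : + 550 * (r * r) ≤ norm base
      large = subst₂ _≤_ (trans (ℤ.pos-* 550 (ρ ℕ.* ρ))
            (cong (+ 550 *_) (trans (cong (λ m → + (m ℕ.* m)) (sym hit)) (∣i∣²≡i² r))))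
        (sym norm-base) (+≤+ n-large)
      n≡ν : + 3 ∣ (+ n - norm p)
      n≡ν = let q , x≡ = x≈p
                t , eq = norm-≈ p q
            in divides t (trans (cong (_- norm p) (trans (sym norm-x) (trans (cong norm x≡) eq)))
                      (cancel (norm p) t))
        where
        cancel : ∀ a t → a + + 3 * t - a ≡ t * + 3
        cancel = solve-∀
      module S = Search ρ n base hit r≢0 norm-base large (norm p) n≡ν pᵣ r≡pᵣ

    searchAll : ∀ f p x → x ≈ p → ∣ x₀ x ∣ ≡ ρ → norm x ≡ + n →
      Representation ρ n ⊎ Any (All (λ e → e · x ≡ 0ℤ)) (refineAt (norm p) (x₀ p) f 1ℤ identity p [])
    searchAll f p x@(⟨ a , b , c , d ⟩) x≈p@(q , x≡) hit norm-x =
      search x hit norm-x (x₀ p) (x₀ q , cong x₀ x≡) f 1ℤ identity p x x≈p norm-x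
        (quad≡ (row₀ a b c d) (row₁ a b c d) (row₂ a b c d) (row₃ a b c d)) [] []
      where
      row₀ : ∀ a b c d → 1ℤ * a ≡ 1ℤ * a + 0ℤ * b + 0ℤ * c + 0ℤ * d
      row₀ = solve-∀
      row₁ : ∀ a b c d → 1ℤ * b ≡ 0ℤ * a + 1ℤ * b + 0ℤ * c + 0ℤ * d
      row₁ = solve-∀
      row₂ : ∀ a b c d → 1ℤ * c ≡ 0ℤ * a + 0ℤ * b + 1ℤ * c + 0ℤ * d
      row₂ = solve-∀
      row₃ : ∀ a b c d → 1ℤ * d ≡ 0ℤ * a + 0ℤ * b + 0ℤ * c + 1ℤ * d
      row₃ = solve-∀

    conclude : ∀ {R : Set} {P : List Form → Set} {L} → L ≡ [] → R ⊎ Any P L → R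
    conclude refl (inj₁ found) = found

    solved : ∀ f p → Closes f p → ∀ x → x ≈ p → ∣ x₀ x ∣ ≡ ρ → norm x ≡ + n → Representation ρ n
    solved f p closes x x≈p hit norm-x = conclude closes (searchAll f p x x≈p hit norm-x)

    solvedTwoEqual : ∀ r s t → r ≡ 1ℤ + + 3 * s → ∣ r ∣ ≡ ρ → norm ⟨ r , r , r , r + + 3 * t ⟩ ≡ + n →
      ∀ k A p → ClosesTwoEqual k A p → ∀ x → x ≈ p → norm x ≡ norm ⟨ r , r , r , r + + 3 * t ⟩ →
      k • x ≡ mapQ (_· ⟨ r , r , r , r + + 3 * t ⟩) A → Representation ρ n
    solvedTwoEqual r s t r≡ hit norm-base k A p closes x x≈p norm-x linear = conclude closes
      (search base hit norm-base 1ℤ (s , r≡) 0 k A p x x≈p (trans norm-x norm-base) linear twoEqual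
        (second r (r + + 3 * t) ∷ third r (r + + 3 * t) ∷ []))
      where
      base = ⟨ r , r , r , r + + 3 * t ⟩
      second : ∀ r d → - + 3 * r + + 3 * r + 0ℤ * r + 0ℤ * d ≡ 0ℤ
      second = solve-∀
      third : ∀ r d → - + 3 * r + 0ℤ * r + + 3 * r + 0ℤ * d ≡ 0ℤ
      third = solve-∀

    -- With r = 1 + 3s and d = r + 3t, reflecting the vector (r , r , r , d) gives (r , r + 2t , r + 2t , t - r)
    -- up to sign, all units mod 3 unless t = r + 3u; one more reflection then gives three units again.
    threeEqual : ∀ s t → ∣ 1ℤ + + 3 * s ∣ ≡ ρ →
      norm ⟨ 1ℤ + + 3 * s , 1ℤ + + 3 * s , 1ℤ + + 3 * s , 1ℤ + + 3 * s + + 3 * t ⟩ ≡ + n → Representation ρ n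
    threeEqual s t hit norm-base = case residue t of λ where
        (_ , here refl , q , refl) → solvedTwoEqual r s (0ℤ + + 3 * q) refl hit norm-base
          (+ 3) image₃ ⟨ 1ℤ , 1ℤ , 1ℤ , -1ℤ ⟩ refl (first (0ℤ + + 3 * q))
          (⟨ s , s + + 2 * q , s + + 2 * q , q - s ⟩ , quad≡ refl (m₁ s q) (m₁ s q) (m₂ s q))
          (norm-first r (0ℤ + + 3 * q)) (linear-first (0ℤ + + 3 * q))
        (_ , there (there (here refl)) , q , refl) → solvedTwoEqual r s (-1ℤ + + 3 * q) refl hit norm-base
          (+ 3) image₃ ⟨ 1ℤ , -1ℤ , -1ℤ , 1ℤ ⟩ refl (first (-1ℤ + + 3 * q))
          (⟨ s , s + + 2 * q , s + + 2 * q , q - s - 1ℤ ⟩ , quad≡ refl (m₃ s q) (m₃ s q) (m₄ s q))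
          (norm-first r (-1ℤ + + 3 * q)) (linear-first (-1ℤ + + 3 * q))
        -- The first image now has residues (1 , 0 , 0 , 0), so its usable mirrors all fix r. With t
        -- = r + 3u it is (r , 3r + 6u , 3r + 6u , 3u), which is reflected once more.
        (_ , there (here refl) , q , refl) → second (q - s)
              (trans (cong (λ t → norm ⟨ r , r , r , r + + 3 * t ⟩) (t≡r+3u s q)) norm-base)
      where
      r = 1ℤ + + 3 * s
      first : ℤ → Quad ℤ
      first t = ⟨ r , r + + 2 * t , r + + 2 * t , t - r ⟩
      t≡r+3u : ∀ s q → 1ℤ + + 3 * s + + 3 * (q - s) ≡ 1ℤ + + 3 * q
      t≡r+3u = solve-∀
      m₁ : ∀ s q → 1ℤ + + 3 * s + + 2 * (0ℤ + + 3 * q) ≡ 1ℤ + + 3 * (s + + 2 * q)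
      m₁ = solve-∀
      m₂ : ∀ s q → 0ℤ + + 3 * q - (1ℤ + + 3 * s) ≡ -1ℤ + + 3 * (q - s)
      m₂ = solve-∀
      m₃ : ∀ s q → 1ℤ + + 3 * s + + 2 * (-1ℤ + + 3 * q) ≡ -1ℤ + + 3 * (s + + 2 * q)
      m₃ = solve-∀
      m₄ : ∀ s q → -1ℤ + + 3 * q - (1ℤ + + 3 * s) ≡ 1ℤ + + 3 * (q - s - 1ℤ)
      m₄ = solve-∀
      norm-first : ∀ r t → r * r + (r + + 2 * t) * (r + + 2 * t) + (r + + 2 * t) * (r + + 2 * t) + (t - r) *
            (t - r)
        ≡ r * r + r * r + r * r + (r + + 3 * t) * (r + + 3 * t)
      norm-first = solve-∀
      linear-first : ∀ t → + 3 • first t ≡ mapQ (_· ⟨ r , r , r , r + + 3 * t ⟩) image₃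
      linear-first t = quad≡ (l₀ r t) (l₁ r t) (l₁ r t) (l₃ r t)
        where
        l₀ : ∀ r t → + 3 * r ≡ + 3 * r + 0ℤ * r + 0ℤ * r + 0ℤ * (r + + 3 * t)
        l₀ = solve-∀
        l₁ : ∀ r t → + 3 * (r + + 2 * t) ≡ 1ℤ * r + 0ℤ * r + 0ℤ * r + + 2 * (r + + 3 * t)
        l₁ = solve-∀
        l₃ : ∀ r t → + 3 * (t - r) ≡ - + 4 * r + 0ℤ * r + 0ℤ * r + 1ℤ * (r + + 3 * t)
        l₃ = solve-∀
      second : ∀ u → norm ⟨ r , r , r , r + + 3 * (r + + 3 * u) ⟩ ≡ + n → Representation ρ n
      second u norm-base = case residue u of λ where
          -- The second mirror is (0 , 1 , 1 , 1), up to signs of the result. The mirror used for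
          -- the other residues of u would leave r as the only coordinate prime to 3.
          (_ , here refl , w , refl) → solvedTwoEqual r s (r + + 3 * (0ℤ + + 3 * w)) refl hit norm-base
            (+ 9) image₉′ ⟨ 1ℤ , 1ℤ , 1ℤ , -1ℤ ⟩ refl
            ⟨ r , r + + 4 * (0ℤ + + 3 * w) , r + + 4 * (0ℤ + + 3 * w) , - + 4 * r - + 7 * (0ℤ + + 3 * w) ⟩
            (⟨ s , s + + 4 * w , s + + 4 * w , - 1ℤ - + 4 * s - + 7 * w ⟩ , quad≡ refl (k₁ s w) (k₁ s w) (k₂ s w))
            (norm-second′ r (0ℤ + + 3 * w))
            (quad≡ (l₀ r (0ℤ + + 3 * w)) (l₄ r (0ℤ + + 3 * w)) (l₄ r (0ℤ + + 3 * w)) (l₅ r (0ℤ + + 3 * w)))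
          -- The second mirror is (0 , 1 , -1 , 1), up to signs and order: the coordinates r, 3r +
          -- 8u, 3r + 4u, u are all prime to 3 because u is.
          (_ , there (here refl) , w , refl) → solvedTwoEqual r s (r + + 3 * (1ℤ + + 3 * w)) refl hit norm-base
            (+ 9) image₉ ⟨ 1ℤ , 1ℤ , -1ℤ , 1ℤ ⟩ refl (x (1ℤ + + 3 * w))
            (⟨ s , - r - + 3 - + 8 * w , - r - 1ℤ - + 4 * w , w ⟩ , quad≡ refl (k₃ r w) (k₄ r w) refl)
            (norm-second r (1ℤ + + 3 * w)) (linear-second (1ℤ + + 3 * w))
          (_ , there (there (here refl)) , w , refl) → solvedTwoEqual r s
                (r + + 3 * (-1ℤ + + 3 * w)) refl hit norm-base
            (+ 9) image₉ ⟨ 1ℤ , -1ℤ , 1ℤ , -1ℤ ⟩ refl (x (-1ℤ + + 3 * w))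
            (⟨ s , - r + + 3 - + 8 * w , - r + 1ℤ - + 4 * w , w ⟩ , quad≡ refl (k₅ r w) (k₆ r w) refl)
            (norm-second r (-1ℤ + + 3 * w)) (linear-second (-1ℤ + + 3 * w))
        where
        x : ℤ → Quad ℤ
        x u = ⟨ r , - + 3 * r - + 8 * u , - + 3 * r - + 4 * u , u ⟩
        k₁ : ∀ s w → 1ℤ + + 3 * s + + 4 * (0ℤ + + 3 * w) ≡ 1ℤ + + 3 * (s + + 4 * w)
        k₁ = solve-∀
        k₂ : ∀ s w → - + 4 * (1ℤ + + 3 * s) - + 7 * (0ℤ + + 3 * w) ≡ -1ℤ + + 3 * (- 1ℤ - + 4 * s - + 7 * w)
        k₂ = solve-∀
        k₃ : ∀ r w → - + 3 * r - + 8 * (1ℤ + + 3 * w) ≡ 1ℤ + + 3 * (- r - + 3 - + 8 * w)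
        k₃ = solve-∀
        k₄ : ∀ r w → - + 3 * r - + 4 * (1ℤ + + 3 * w) ≡ -1ℤ + + 3 * (- r - 1ℤ - + 4 * w)
        k₄ = solve-∀
        k₅ : ∀ r w → - + 3 * r - + 8 * (-1ℤ + + 3 * w) ≡ -1ℤ + + 3 * (- r + + 3 - + 8 * w)
        k₅ = solve-∀
        k₆ : ∀ r w → - + 3 * r - + 4 * (-1ℤ + + 3 * w) ≡ 1ℤ + + 3 * (- r + 1ℤ - + 4 * w)
        k₆ = solve-∀
        norm-second : ∀ r u →
          r * r + (- + 3 * r - + 8 * u) * (- + 3 * r - + 8 * u) + (- + 3 * r - + 4 * u) *
                (- + 3 * r - + 4 * u) + u * u
          ≡ r * r + r * r + r * r + (r + + 3 * (r + + 3 * u)) * (r + + 3 * (r + + 3 * u))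
        norm-second = solve-∀
        norm-second′ : ∀ r u →
          r * r + (r + + 4 * u) * (r + + 4 * u) + (r + + 4 * u) * (r + + 4 * u) + (- + 4 * r - + 7 * u) *
                (- + 4 * r - + 7 * u)
          ≡ r * r + r * r + r * r + (r + + 3 * (r + + 3 * u)) * (r + + 3 * (r + + 3 * u))
        norm-second′ = solve-∀
        l₀ : ∀ r u → + 9 * r ≡ + 9 * r + 0ℤ * r + 0ℤ * r + 0ℤ * (r + + 3 * (r + + 3 * u))
        l₀ = solve-∀
        l₁ : ∀ r u → + 9 * (- + 3 * r - + 8 * u) ≡ + 5 * r + 0ℤ * r + 0ℤ * r + - + 8 * (r + + 3 * (r + + 3 * u))
        l₁ = solve-∀
        l₂ : ∀ r u → + 9 * (- + 3 * r - + 4 * u) ≡ - + 11 * r + 0ℤ * r + 0ℤ * r + - + 4 *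
              (r + + 3 * (r + + 3 * u))
        l₂ = solve-∀
        l₃ : ∀ r u → + 9 * u ≡ - + 4 * r + 0ℤ * r + 0ℤ * r + 1ℤ * (r + + 3 * (r + + 3 * u))
        l₃ = solve-∀
        l₄ : ∀ r u → + 9 * (r + + 4 * u) ≡ - + 7 * r + 0ℤ * r + 0ℤ * r + + 4 * (r + + 3 * (r + + 3 * u))
        l₄ = solve-∀
        l₅ : ∀ r u → + 9 * (- + 4 * r - + 7 * u) ≡ - + 8 * r + 0ℤ * r + 0ℤ * r + - + 7 * (r + + 3 * (r + + 3 * u))
        l₅ = solve-∀
        linear-second : ∀ u → + 9 • x u ≡ mapQ (_· ⟨ r , r , r , r + + 3 * (r + + 3 * u) ⟩) image₉
        linear-second u = quad≡ (l₀ r u) (l₁ r u) (l₂ r u) (l₃ r u)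

    allUnits : ∀ r b c d → (∃[ s ] r ≡ 1ℤ + + 3 * s) → (∃[ i ] b ≡ 1ℤ + + 3 * i) →
      (∃[ j ] c ≡ 1ℤ + + 3 * j) → (∃[ k ] d ≡ 1ℤ + + 3 * k) →
      ∣ r ∣ ≡ ρ → norm ⟨ r , b , c , d ⟩ ≡ + n → Representation ρ n
    allUnits r b c d (s , r≡) (i , b≡) (j , c≡) (k , d≡) hit norm-x = [ (λ found → found) , leaf ]′
      (Sum.map₂ (subst (Any (All (λ e → e · ⟨ r , b , c , d ⟩ ≡ 0ℤ))) leaves₁₁₁₁)
        (searchAll 0 ⟨ 1ℤ , 1ℤ , 1ℤ , 1ℤ ⟩ ⟨ r , b , c , d ⟩ (⟨ s , i , j , k ⟩ , quad≡ r≡ b≡ c≡ d≡) hit norm-x))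
      where
      -- The forms in `leaves` vanish at (1 , 1 , 1 , 1), so their coefficients sum to 0; once y = r
      -- the equation reads γ (d - r) = 0.
      fourth : ∀ {y} → y ≡ r → ∀ α β γ {{_ : NonZero γ}} → α + β + γ ≡ 0ℤ → α * r + β * y + γ * d ≡ 0ℤ → d ≡ r
      fourth refl α β γ sum e = ℤ.*-cancelˡ-≡ γ d r (ℤ.i-j≡0⇒i≡j (γ * d) (γ * r)
        (trans (rearrange α β γ r d) (trans (cong₂ (λ s t → s - t * r) e sum) (vanish r))))
        where
        rearrange : ∀ α β γ r d → γ * d - γ * r ≡ α * r + β * r + γ * d - (α + β + γ) * r
        rearrange = solve-∀
        vanish : ∀ r → 0ℤ - 0ℤ * r ≡ 0ℤ
        vanish = solve-∀
      omit-b : ∀ α β γ → α * r + β * c + γ * d ≡ α * r + 0ℤ * b + β * c + γ * d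
      omit-b α β γ = general r b c d α β γ
        where
        general : ∀ r b c d α β γ → α * r + β * c + γ * d ≡ α * r + 0ℤ * b + β * c + γ * d
        general = solve-∀
      omit-c : ∀ α β γ → α * r + β * b + γ * d ≡ α * r + β * b + 0ℤ * c + γ * d
      omit-c α β γ = general r b c d α β γ
        where
        general : ∀ r b c d α β γ → α * r + β * b + γ * d ≡ α * r + β * b + 0ℤ * c + γ * d
        general = solve-∀
      equal : ∀ y → + 3 * y - + 3 * r ≡ 0ℤ → y ≡ r
      equal y e = ℤ.*-cancelˡ-≡ (+ 3) y r (ℤ.i-j≡0⇒i≡j (+ 3 * y) (+ 3 * r) e)
      second : - + 3 * r + + 3 * b + 0ℤ * c + 0ℤ * d ≡ 0ℤ → b ≡ r
      second e = equal b (trans (drop r b c d) e)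
        where
        drop : ∀ r b c d → + 3 * b - + 3 * r ≡ - + 3 * r + + 3 * b + 0ℤ * c + 0ℤ * d
        drop = solve-∀
      third : - + 3 * r + 0ℤ * b + + 3 * c + 0ℤ * d ≡ 0ℤ → c ≡ r
      third e = equal c (trans (drop r b c d) e)
        where
        drop : ∀ r b c d → + 3 * c - + 3 * r ≡ - + 3 * r + 0ℤ * b + + 3 * c + 0ℤ * d
        drop = solve-∀
      free : ∀ y → (∃[ i ] y ≡ 1ℤ + + 3 * i) → norm ⟨ r , r , r , y ⟩ ≡ + n → Representation ρ n
      free y (i , refl) eq = threeEqual s (i - s) (trans (cong ∣_∣ (sym r≡)) hit)
        (trans (cong₂ (λ r y → norm ⟨ r , r , r , y ⟩) (sym r≡) (shift s i)) eq)
        where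
        shift : ∀ s i → 1ℤ + + 3 * s + + 3 * (i - s) ≡ 1ℤ + + 3 * i
        shift = solve-∀
      b-free : c ≡ r → d ≡ r → Representation ρ n
      b-free c≡r d≡r = free b (i , b≡) (trans (rotate (r * r) (b * b))
        (trans (cong₂ (λ c d → r * r + b * b + c * c + d * d) (sym c≡r) (sym d≡r)) norm-x))
        where
        rotate : ∀ r b → r + r + r + b ≡ r + b + r + r
        rotate = solve-∀
      c-free : b ≡ r → d ≡ r → Representation ρ n
      c-free b≡r d≡r = free c (j , c≡) (trans (rotate (r * r) (c * c))
        (trans (cong₂ (λ b d → r * r + b * b + c * c + d * d) (sym b≡r) (sym d≡r)) norm-x))
        where
        rotate : ∀ r c → r + r + r + c ≡ r + r + c + r
        rotate = solve-∀
      d-free : b ≡ r → c ≡ r → Representation ρ n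
      d-free b≡r c≡r = free d (k , d≡)
        (trans (cong₂ (λ b c → r * r + b * b + c * c + d * d) (sym b≡r) (sym c≡r)) norm-x)
      b-free′ : - + 3 * r + 0ℤ * b + + 3 * c + 0ℤ * d ≡ 0ℤ → ∀ β γ {{_ : NonZero γ}} α → α + β + γ ≡ 0ℤ →
        α * r + 0ℤ * b + β * c + γ * d ≡ 0ℤ → Representation ρ n
      b-free′ c=r β γ α sum e = b-free (third c=r) (fourth (third c=r) α β γ sum (trans (omit-b α β γ) e))
      c-free′ : - + 3 * r + + 3 * b + 0ℤ * c + 0ℤ * d ≡ 0ℤ → ∀ β γ {{_ : NonZero γ}} α → α + β + γ ≡ 0ℤ →
        α * r + β * b + 0ℤ * c + γ * d ≡ 0ℤ → Representation ρ n
      c-free′ b=r β γ α sum e = c-free (second b=r) (fourth (second b=r) α β γ sum (trans (omit-c α β γ) e))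
      leaf : Any (All (λ e → e · ⟨ r , b , c , d ⟩ ≡ 0ℤ)) leaves → Representation ρ n
      leaf (here (c=r ∷ e ∷ [])) = b-free′ c=r (- + 2) (- + 2) (+ 4) refl e
      leaf (there (here (e ∷ b=r ∷ []))) = c-free′ b=r (- + 2) (- + 2) (+ 4) refl e
      leaf (there (there (here (e ∷ b=r ∷ [])))) = c-free′ b=r (+ 1) (- + 2) (+ 1) refl e
      leaf (there (there (there (here (c=r ∷ b=r ∷ []))))) = d-free (second b=r) (third c=r)
      leaf (there (there (there (there (here (e ∷ b=r ∷ [])))))) = c-free′ b=r (- + 2) (+ 1) (+ 1) refl e
      leaf (there (there (there (there (there (here (c=r ∷ e ∷ []))))))) = b-free′ c=r (+ 1) (- + 2) (+ 1) refl e
      leaf (there (there (there (there (there (there (here (c=r ∷ e ∷ [])))))))) = b-free′ c=r (- + 2) (+ 1)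
            (+ 1) refl e

    twoUnits : ∀ q q′ {c d} → Residue c → Residue d → ∣ 1ℤ + + 3 * q ∣ ≡ ρ →
      norm ⟨ 1ℤ + + 3 * q , 1ℤ + + 3 * q′ , c , d ⟩ ≡ + n → Representation ρ n
    twoUnits q q′ (multiple i) (multiple j) hit norm-x = solved 0 ⟨ 1ℤ , 1ℤ , 0ℤ , 0ℤ ⟩ closes₁₁₀₀
      ⟨ 1ℤ + + 3 * q , 1ℤ + + 3 * q′ , + 3 * i , + 3 * j ⟩
      (⟨ q , q′ , i , j ⟩ , quad≡ refl refl (sym (ℤ.+-identityˡ (+ 3 * i)))
            (sym (ℤ.+-identityˡ (+ 3 * j)))) hit norm-x
    twoUnits q q′ (unit i) (multiple j) hit norm-x = solved 1 ⟨ 1ℤ , 1ℤ , 1ℤ , 0ℤ ⟩ closes₁₁₁₀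
      ⟨ 1ℤ + + 3 * q , 1ℤ + + 3 * q′ , 1ℤ + + 3 * i , + 3 * j ⟩
      (⟨ q , q′ , i , j ⟩ , quad≡ refl refl refl (sym (ℤ.+-identityˡ (+ 3 * j)))) hit norm-x
    twoUnits q q′ {c} {d} (multiple i) (unit j) hit norm-x = twoUnits q q′ (unit j) (multiple i) hit
      (trans (norm-swap₂₃ (1ℤ + + 3 * q) (1ℤ + + 3 * q′) d c) norm-x)
    twoUnits q q′ (unit i) (unit j) hit norm-x =
      allUnits (1ℤ + + 3 * q) (1ℤ + + 3 * q′) (1ℤ + + 3 * i) (1ℤ + + 3 * j)
        (q , refl) (q′ , refl) (i , refl) (j , refl) hit norm-x

    -- The case where ± ρ is neither of the two coordinates already known to be prime to 3. If it is
    -- prime to 3 as well, `twoUnits` applies.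
    twoUnitsBehind : ∀ q q′ {r d} → Residue r → Residue d → ∣ r ∣ ≡ ρ →
      norm ⟨ r , 1ℤ + + 3 * q , 1ℤ + + 3 * q′ , d ⟩ ≡ + n → Representation ρ n
    twoUnitsBehind q q′ (unit s) rd hit norm-x = twoUnits s q (unit q′) rd hit norm-x
    twoUnitsBehind q q′ (multiple s) (unit j) hit norm-x = solved 0 ⟨ 0ℤ , 1ℤ , 1ℤ , 1ℤ ⟩ closes₀₁₁₁
      ⟨ + 3 * s , 1ℤ + + 3 * q , 1ℤ + + 3 * q′ , 1ℤ + + 3 * j ⟩
      (⟨ s , q , q′ , j ⟩ , quad≡ (sym (ℤ.+-identityˡ (+ 3 * s))) refl refl refl) hit norm-x
    twoUnitsBehind q q′ (multiple s) (multiple j) hit norm-x = solved 1 ⟨ 0ℤ , 0ℤ , 1ℤ , 1ℤ ⟩ closes₀₀₁₁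
      ⟨ + 3 * s , + 3 * j , 1ℤ + + 3 * q , 1ℤ + + 3 * q′ ⟩
      (⟨ s , j , q , q′ ⟩ , quad≡ (sym (ℤ.+-identityˡ (+ 3 * s))) (sym (ℤ.+-identityˡ (+ 3 * j))) refl refl) hit
      (trans (norm-rotate (+ 3 * s) (+ 3 * j) (1ℤ + + 3 * q) (1ℤ + + 3 * q′)) norm-x)

    fromTwoUnits : ∀ q q′ c d → norm ⟨ 1ℤ + + 3 * q , 1ℤ + + 3 * q′ , c , d ⟩ ≡ + n → Representation ρ n
    fromTwoUnits q q′ c d norm-x =
      let c′ , ∣c∣ , rc = normalise c
          d′ , ∣d∣ , rd = normalise d
          a = 1ℤ + + 3 * q
          b = 1ℤ + + 3 * q′
          norm-x′ : norm ⟨ a , b , c′ , d′ ⟩ ≡ + n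
          norm-x′ = trans (cong₂ (λ s t → a * a + b * b + s + t)
            (∣i∣≡∣j∣⇒i²≡j² {c′} {c} ∣c∣) (∣i∣≡∣j∣⇒i²≡j² {d′} {d} ∣d∣)) norm-x
      in case avoids-or-hits ρ n ⟨ a , b , c′ , d′ ⟩ norm-x′ of λ where
        (inj₁ found) → found
        (inj₂ (here hit)) → twoUnits q q′ rc rd hit norm-x′
        (inj₂ (there (here hit))) → twoUnits q′ q rc rd hit (trans (norm-swap₀₁ b a c′ d′) norm-x′)
        (inj₂ (there (there (here hit)))) → twoUnitsBehind q q′ rc rd hit (trans (norm-front c′ a b d′) norm-x′)
        (inj₂ (there (there (there (here hit))))) → twoUnitsBehind q q′ rd rc hit
          (trans (norm-front d′ a b c′) (trans (norm-swap₂₃ a b d′ c′) norm-x′))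

    -- Only the last three coordinates are replaced, so a unit in first place survives a second
    -- application. If those three vanish, n = a² is a representation by one square, and ∣ a ∣ = ρ
    -- is impossible as n ≥ 550 ρ² > ρ².
    unitFirst : ∀ a b c d → norm ⟨ a , b , c , d ⟩ ≡ + n →
      Representation ρ n ⊎ (∃[ q ] ∃[ c′ ] ∃[ d′ ] norm ⟨ 1ℤ + + 3 * q , a , c′ , d′ ⟩ ≡ + n)
    unitFirst a b c d norm-x with ∣ sumSq₃ b c d ∣ ℕ.≟ 0
    ... | no m≢0 =
      let q , c′ , d′ , eq = primitive-sum ∣ sumSq₃ b c d ∣ m≢0 b c d (sym +m≡)
      in inj₂ (q , c′ , d′ , trans (norm-split (1ℤ + + 3 * q) a c′ d′)
        (trans (cong (λ s → a * a + s) (trans eq +m≡)) (trans (norm-split′ a b c d) norm-x)))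
      where
      +m≡ : + ∣ sumSq₃ b c d ∣ ≡ sumSq₃ b c d
      +m≡ = ℤ.0≤i⇒+∣i∣≡i (ℤ.+-mono-≤ (ℤ.+-mono-≤ (0≤i*i b) (0≤i*i c)) (0≤i*i d))
      norm-split : ∀ u a c d → u * u + a * a + c * c + d * d ≡ a * a + (u * u + c * c + d * d)
      norm-split = solve-∀
      norm-split′ : ∀ a b c d → a * a + (b * b + c * c + d * d) ≡ a * a + b * b + c * c + d * d
      norm-split′ = solve-∀
    ... | yes m≡0 = inj₁ (∣ a ∣ ∷ [] , s≤s z≤n , avoid ∷ [] , n≡a²)
      where
      split : ∀ a b c d → a * a + b * b + c * c + d * d ≡ a * a + (b * b + c * c + d * d)
      split = solve-∀
      n≡a² : n ≡ ∣ a ∣ ℕ.* ∣ a ∣ ℕ.+ 0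
      n≡a² = trans (ℤ.+-injective (trans (sym norm-x) (trans (split a b c d)
        (trans (cong (λ s → a * a + s) (ℤ.∣i∣≡0⇒i≡0 m≡0)) (trans (ℤ.+-identityʳ (a * a)) (sym (∣i∣²≡i² a)))))))
        (sym (ℕ.+-identityʳ (∣ a ∣ ℕ.* ∣ a ∣)))
      avoid : ∣ a ∣ ≢ ρ
      avoid refl = ℕ.<-irrefl refl (begin-strict
        ∣ a ∣ ℕ.* ∣ a ∣              <⟨ ℕ.m<m+n (∣ a ∣ ℕ.* ∣ a ∣)
              (ℕ.*-mono-≤ (s≤s (z≤n {548})) (ℕ.*-mono-≤ 1≤ρ 1≤ρ)) ⟩
        550 ℕ.* (∣ a ∣ ℕ.* ∣ a ∣)    ≤⟨ n-large ⟩
        n                            ≡⟨ n≡a² ⟩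
        ∣ a ∣ ℕ.* ∣ a ∣ ℕ.+ 0        ≡⟨ ℕ.+-identityʳ _ ⟩
        ∣ a ∣ ℕ.* ∣ a ∣              ∎)
        where open ℕ.≤-Reasoning

    fromAny : ∀ x → norm x ≡ + n → Representation ρ n
    fromAny ⟨ a , b , c , d ⟩ norm-x = case unitFirst a b c d norm-x of λ where
      (inj₁ found) → found
      (inj₂ (q , c′ , d′ , norm-x′)) → case unitFirst (1ℤ + + 3 * q) a c′ d′ norm-x′ of λ where
        (inj₁ found) → found
        (inj₂ (q′ , c″ , d″ , norm-x″)) → fromTwoUnits q′ q c″ d″ norm-x″

  -- Lagrange's four square theorem

  FourSquares : ℕ → Set
  FourSquares n = ∃[ x ] norm x ≡ + n

  -- The quaternion product of the first argument with the conjugate of the second.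
  _⊛_ : Quad ℤ → Quad ℤ → Quad ℤ
  ⟨ a , b , c , d ⟩ ⊛ ⟨ a′ , b′ , c′ , d′ ⟩ =
    ⟨ a * a′ + b * b′ + c * c′ + d * d′ , b * a′ - a * b′ + d * c′ - c * d′
    , c * a′ - a * c′ + b * d′ - d * b′ , d * a′ - a * d′ + c * b′ - b * c′ ⟩

  norm-⊛ : ∀ x y → norm (x ⊛ y) ≡ norm x * norm y
  norm-⊛ ⟨ a , b , c , d ⟩ ⟨ a′ , b′ , c′ , d′ ⟩ = euler a b c d a′ b′ c′ d′
    where
    euler : ∀ a b c d a′ b′ c′ d′ →
      (a * a′ + b * b′ + c * c′ + d * d′) * (a * a′ + b * b′ + c * c′ + d * d′)
        + (b * a′ - a * b′ + d * c′ - c * d′) * (b * a′ - a * b′ + d * c′ - c * d′)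
        + (c * a′ - a * c′ + b * d′ - d * b′) * (c * a′ - a * c′ + b * d′ - d * b′)
        + (d * a′ - a * d′ + c * b′ - b * c′) * (d * a′ - a * d′ + c * b′ - b * c′)
      ≡ (a * a + b * b + c * c + d * d) * (a′ * a′ + b′ * b′ + c′ * c′ + d′ * d′)
    euler = solve-∀

  fourSquares-* : ∀ {m n} → FourSquares m → FourSquares n → FourSquares (m ℕ.* n)
  fourSquares-* {m} {n} (x , x≡) (y , y≡) = x ⊛ y , trans (norm-⊛ x y)
        (trans (cong₂ _*_ x≡ y≡) (sym (ℤ.pos-* m n)))

  norm≥0 : ∀ x → 0ℤ ≤ norm x
  norm≥0 ⟨ a , b , c , d ⟩ = ℤ.+-mono-≤ (ℤ.+-mono-≤ (ℤ.+-mono-≤ (0≤i*i a) (0≤i*i b)) (0≤i*i c)) (0≤i*i d)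

  sum₂≡0 : ∀ {i j} → 0ℤ ≤ i → 0ℤ ≤ j → i + j ≡ 0ℤ → i ≡ 0ℤ × j ≡ 0ℤ
  sum₂≡0 {+ a} {+ b} _ _ eq = cong +_ (ℕ.m+n≡0⇒m≡0 a (ℤ.+-injective eq)) , cong +_
        (ℕ.m+n≡0⇒n≡0 a (ℤ.+-injective eq))

  sum₄≡0 : ∀ {i j k l} → 0ℤ ≤ i → 0ℤ ≤ j → 0ℤ ≤ k → 0ℤ ≤ l → i + j + k + l ≡ 0ℤ →
    i ≡ 0ℤ × j ≡ 0ℤ × k ≡ 0ℤ × l ≡ 0ℤ
  sum₄≡0 pi pj pk pl eq =
    let ijk , l≡0 = sum₂≡0 (ℤ.+-mono-≤ (ℤ.+-mono-≤ pi pj) pk) pl eq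
        ij , k≡0 = sum₂≡0 (ℤ.+-mono-≤ pi pj) pk ijk
        i≡0 , j≡0 = sum₂≡0 pi pj ij
    in i≡0 , j≡0 , k≡0 , l≡0

  norm-• : ∀ k x → norm (k • x) ≡ k * k * norm x
  norm-• k ⟨ a , b , c , d ⟩ = factor k a b c d
    where
    factor : ∀ k a b c d → k * a * (k * a) + k * b * (k * b) + k * c * (k * c) + k * d * (k * d)
      ≡ k * k * (a * a + b * b + c * c + d * d)
    factor = solve-∀

  leastResidue : ∀ m .{{_ : ℕ.NonZero m}} z → ∃[ y ] ∃[ q ] (z ≡ y + + m * q × 2 ℕ.* ∣ y ∣ ℕ.≤ m)
  leastResidue m z with 2 ℕ.* (z %ℕ m) ℕ.≤? m
  ... | yes small = + (z %ℕ m) , z /ℕ m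
                  , trans (a≡a%ℕn+[a/ℕn]*n z m) (cong (λ s → + (z %ℕ m) + s) (ℤ.*-comm (z /ℕ m) (+ m))) , small
  ... | no ¬small = - + t , z /ℕ m + 1ℤ
                  , trans (a≡a%ℕn+[a/ℕn]*n z m) (trans (cong (λ s → + r + (z /ℕ m) * s) +m≡)
                        (trans (shift (+ r) (+ t) (z /ℕ m)) (cong (λ s → - + t + s * (z /ℕ m + 1ℤ)) (sym +m≡))))
                  , subst (λ s → 2 ℕ.* s ℕ.≤ m) (sym (ℤ.∣-i∣≡∣i∣ (+ t))) 2t≤m
    where
    r = z %ℕ m
    t = m ℕ.∸ r
    m≡ : m ≡ r ℕ.+ t
    m≡ = sym (ℕ.m+[n∸m]≡n (ℕ.<⇒≤ (n%ℕd<d z m)))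
    +m≡ : + m ≡ + r + + t
    +m≡ = cong +_ m≡
    shift : ∀ r t q → r + q * (r + t) ≡ - t + (r + t) * (q + 1ℤ)
    shift = solve-∀
    2t≤m : 2 ℕ.* t ℕ.≤ m
    2t≤m = ℕ.≤-trans (ℕ.+-monoʳ-≤ t (ℕ.≤-trans (ℕ.≤-reflexive (ℕ.+-identityʳ t)) t≤r))
          (ℕ.≤-reflexive (trans (ℕ.+-comm t r) (sym m≡)))
      where
      t≤r : t ℕ.≤ r
      t≤r = ℕ.+-cancelˡ-≤ r t r (ℕ.<⇒≤ (subst₂ ℕ._<_ m≡ (cong (r ℕ.+_) (ℕ.+-identityʳ r)) (ℕ.≰⇒> ¬small)))

  double-square : ∀ i → + 4 * (i * i) ≡ + (2 ℕ.* ∣ i ∣ ℕ.* (2 ℕ.* ∣ i ∣))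
  double-square i = trans (regroup i)
        (trans (sym (∣i∣²≡i² (+ 2 * i))) (cong (λ s → + (s ℕ.* s)) (ℤ.abs-* (+ 2) i)))
    where
    regroup : ∀ i → + 4 * (i * i) ≡ + 2 * i * (+ 2 * i)
    regroup = solve-∀

  -- Descent on the multiples of a prime that are sums of four squares

  module Descent (p : ℕ) (p-prime : Prime p) where

    private
      instance
        p≢0 : ℕ.NonZero p
        p≢0 = prime⇒nonZero p-prime

    no-divisor : ∀ {m} k → 1 ℕ.< m → m ℕ.< p → + p ≢ + m * k
    no-divisor {m} k 1<m m<p p≡ = [ (λ m≡1 → ℕ.<-irrefl (sym m≡1) 1<m) , (λ m≡p → ℕ.<-irrefl m≡p m<p) ]′
      (prime⇒irreducible p-prime (ℕ.divides ∣ k ∣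
            (trans (cong ∣_∣ p≡) (trans (ℤ.abs-* (+ m) k) (ℕ.*-comm m ∣ k ∣)))))

    module Step (m : ℕ) (1<m : 1 ℕ.< m) (m<p : m ℕ.< p) (y q : Quad ℤ)
      (small₀ : + 4 * (x₀ y * x₀ y) ≤ + m * + m) (small₁ : + 4 * (x₁ y * x₁ y) ≤ + m * + m)
      (small₂ : + 4 * (x₂ y * x₂ y) ≤ + m * + m) (small₃ : + 4 * (x₃ y * x₃ y) ≤ + m * + m)
      (norm-x : norm (zipQ _+_ y (+ m • q)) ≡ + m * + p) where
      private
        instance
          m≢0 : ℕ.NonZero m
          m≢0 = ℕ.>-nonZero (ℕ.<-trans (s≤s z≤n) 1<m)
          +m≢0 : NonZero (+ m)
          +m≢0 = m≢0

          m-positive : Positive (+ m)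
          m-positive = positive (+<+ (ℕ.<-trans (s≤s z≤n) 1<m))

      r : ℤ
      r = + p - + 2 * (y · q) - + m * norm q

      norm-y : norm y ≡ + m * r
      norm-y = trans (complete y q) (trans (cong (λ s → s - + m * (+ 2 * (y · q)) - + m * (+ m * norm q)) norm-x)
        (factor (+ m) (+ p) (+ 2 * (y · q)) (+ m * norm q)))
        where
        complete : ∀ y q → norm y ≡ norm (zipQ _+_ y (+ m • q)) - + m * (+ 2 * (y · q)) - + m * (+ m * norm q)
        complete ⟨ a , b , c , d ⟩ ⟨ a′ , b′ , c′ , d′ ⟩ = expanded (+ m) a b c d a′ b′ c′ d′
          where
          expanded : ∀ m a b c d a′ b′ c′ d′ → a * a + b * b + c * c + d * d
            ≡ (a + m * a′) * (a + m * a′) + (b + m * b′) * (b + m * b′) + (c + m * c′) * (c + m * c′) +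
                  (d + m * d′) * (d + m * d′)
              - m * (+ 2 * (a * a′ + b * b′ + c * c′ + d * d′)) - m *
                    (m * (a′ * a′ + b′ * b′ + c′ * c′ + d′ * d′))
          expanded = solve-∀
        factor : ∀ m p s t → m * p - m * s - m * t ≡ m * (p - s - t)
        factor = solve-∀

      0≤r : 0ℤ ≤ r
      0≤r = ℤ.*-cancelˡ-≤-pos 0ℤ r (+ m) {{m-positive}}
        (subst₂ _≤_ (sym (ℤ.*-zeroʳ (+ m))) norm-y (norm≥0 y))

      4norm-y : + 4 * norm y ≡ + 4 * (x₀ y * x₀ y) + + 4 * (x₁ y * x₁ y) + + 4 * (x₂ y * x₂ y) + + 4 *
            (x₃ y * x₃ y)
      4norm-y = distribute (x₀ y * x₀ y) (x₁ y * x₁ y) (x₂ y * x₂ y) (x₃ y * x₃ y)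
        where
        distribute : ∀ a b c d → + 4 * (a + b + c + d) ≡ + 4 * a + + 4 * b + + 4 * c + + 4 * d
        distribute = solve-∀

      r≤m : r ≤ + m
      r≤m = ℤ.*-cancelˡ-≤-pos r (+ m) (+ m) (ℤ.*-cancelˡ-≤-pos (+ m * r) (+ m * + m) (+ 4)
        (subst₂ _≤_ (trans (sym 4norm-y) (cong (+ 4 *_) norm-y)) (collect (+ m * + m))
          (ℤ.+-mono-≤ (ℤ.+-mono-≤ (ℤ.+-mono-≤ small₀ small₁) small₂) small₃)))
        where
        collect : ∀ a → a + a + a + a ≡ + 4 * a
        collect = solve-∀

      -- r = 0 forces y = 0, and then p = m norm q has the proper divisor m.
      r≢0 : r ≢ 0ℤ
      r≢0 r≡0 = no-divisor (norm q) 1<m m<p (trans (isolate (+ p) (+ 2 * (y · q)) (+ m * norm q))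
        (trans (cong₂ (λ s t → s + + 2 * t + + m * norm q) r≡0 y·q≡0) (drop (+ m * norm q))))
        where
        norm-y≡0 : norm y ≡ 0ℤ
        norm-y≡0 = trans norm-y (trans (cong (+ m *_) r≡0) (ℤ.*-zeroʳ (+ m)))
        y·q≡0 : y · q ≡ 0ℤ
        y·q≡0 =
          let y₀ , y₁ , y₂ , y₃ =
                sum₄≡0 (0≤i*i (x₀ y)) (0≤i*i (x₁ y)) (0≤i*i (x₂ y)) (0≤i*i (x₃ y)) norm-y≡0
          in cong₂ _+_ (cong₂ _+_ (cong₂ _+_
               (term (x₀ y) (x₀ q) y₀) (term (x₁ y) (x₁ q) y₁)) (term (x₂ y) (x₂ q) y₂)) (term (x₃ y) (x₃ q) y₃)
          where
          term : ∀ i j → i * i ≡ 0ℤ → i * j ≡ 0ℤ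
          term i j i²≡0 = trans (cong (_* j) ([ (λ z → z) , (λ z → z) ]′ (ℤ.i*j≡0⇒i≡0∨j≡0 i i²≡0))) (ℤ.*-zeroˡ j)
        isolate : ∀ p s t → p ≡ p - s - t + s + t
        isolate = solve-∀
        drop : ∀ t → 0ℤ + + 2 * 0ℤ + t ≡ t
        drop = solve-∀

      -- Least residues may reach m / 2 when m is even, and r = m makes all four equal to ± m / 2.
      -- Then m divides 2 (y · q) and hence p. Primality thus replaces the usual separate halving of
      -- an even m.
      r≢m : r ≢ + m
      r≢m r≡m =
        let g₀ , g₁ , g₂ , g₃ =
              sum₄≡0 (ℤ.i≤j⇒0≤j-i small₀) (ℤ.i≤j⇒0≤j-i small₁) (ℤ.i≤j⇒0≤j-i small₂) (ℤ.i≤j⇒0≤j-i small₃) gaps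
            e₀ , h₀ = half (x₀ y) g₀
            e₁ , h₁ = half (x₁ y) g₁
            e₂ , h₂ = half (x₂ y) g₂
            e₃ , h₃ = half (x₃ y) g₃
            e = ⟨ e₀ , e₁ , e₂ , e₃ ⟩
        in no-divisor (1ℤ + e · q + norm q) 1<m m<p
          (trans (isolate (+ p) (+ 2 * (y · q)) (+ m * norm q))
            (trans (cong₂ (λ s t → s + t + + m * norm q) r≡m
              (trans (distribute (x₀ y) (x₁ y) (x₂ y) (x₃ y) (x₀ q) (x₁ q) (x₂ q) (x₃ q))
                (trans (cong₂ _+_ (cong₂ _+_ (cong₂ _+_ (cong (_* x₀ q) h₀) (cong (_* x₁ q) h₁))
                      (cong (_* x₂ q) h₂)) (cong (_* x₃ q) h₃))
                  (collect (+ m) e₀ e₁ e₂ e₃ (x₀ q) (x₁ q) (x₂ q) (x₃ q)))))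
              (factor (+ m) (e · q) (norm q))))
        where
        half : ∀ i → + m * + m - + 4 * (i * i) ≡ 0ℤ → ∃[ e ] + 2 * i ≡ + m * e
        half i gap≡0 = case square-injective (+ 2 * i) (+ m)
              (trans (regroup i) (sym (ℤ.i-j≡0⇒i≡j (+ m * + m) (+ 4 * (i * i)) gap≡0))) of λ where
            (inj₁ eq) → 1ℤ , trans eq (sym (ℤ.*-identityʳ (+ m)))
            (inj₂ eq) → -1ℤ , trans eq (minus (+ m))
          where
          regroup : ∀ i → + 2 * i * (+ 2 * i) ≡ + 4 * (i * i)
          regroup = solve-∀
          minus : ∀ m → - m ≡ m * -1ℤ
          minus = solve-∀
        gaps : + m * + m - + 4 * (x₀ y * x₀ y) + (+ m * + m - + 4 * (x₁ y * x₁ y))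
          + (+ m * + m - + 4 * (x₂ y * x₂ y)) + (+ m * + m - + 4 * (x₃ y * x₃ y)) ≡ 0ℤ
        gaps = trans (total (+ m) (x₀ y * x₀ y) (x₁ y * x₁ y) (x₂ y * x₂ y) (x₃ y * x₃ y))
          (trans (cong (λ s → + 4 * (+ m * + m) - + 4 * s) (trans norm-y (cong (+ m *_) r≡m)))
                (ℤ.+-inverseʳ (+ 4 * (+ m * + m))))
          where
          total : ∀ m a b c d → m * m - + 4 * a + (m * m - + 4 * b) + (m * m - + 4 * c) + (m * m - + 4 * d)
            ≡ + 4 * (m * m) - + 4 * (a + b + c + d)
          total = solve-∀
        isolate : ∀ p s t → p ≡ p - s - t + s + t
        isolate = solve-∀
        distribute : ∀ a b c d a′ b′ c′ d′ → + 2 * (a * a′ + b * b′ + c * c′ + d * d′)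
          ≡ + 2 * a * a′ + + 2 * b * b′ + + 2 * c * c′ + + 2 * d * d′
        distribute = solve-∀
        collect : ∀ m a b c d a′ b′ c′ d′ → m * a * a′ + m * b * b′ + m * c * c′ + m * d * d′
          ≡ m * (a * a′ + b * b′ + c * c′ + d * d′)
        collect = solve-∀
        factor : ∀ m s t → m + m * s + m * t ≡ m * (1ℤ + s + t)
        factor = solve-∀

      -- For x = y + m q one has x ⊛ y = y ⊛ y + m (q ⊛ y), where y ⊛ y is the real quaternion norm
      -- y = m r; `w` is the quotient by m.
      w : Quad ℤ
      w = zipQ _+_ ⟨ r , 0ℤ , 0ℤ , 0ℤ ⟩ (q ⊛ y)

      x⊛y : zipQ _+_ y (+ m • q) ⊛ y ≡ + m • w
      x⊛y = quad≡
        (trans (z₀ (+ m) (x₀ y) (x₁ y) (x₂ y) (x₃ y) (x₀ q) (x₁ q) (x₂ q) (x₃ q))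
          (trans (cong (λ s → s + + m * (q · y)) norm-y) (sym (ℤ.*-distribˡ-+ (+ m) r (q · y)))))
        (z₁ (+ m) (x₀ y) (x₁ y) (x₂ y) (x₃ y) (x₀ q) (x₁ q) (x₂ q) (x₃ q))
        (z₂ (+ m) (x₀ y) (x₁ y) (x₂ y) (x₃ y) (x₀ q) (x₁ q) (x₂ q) (x₃ q))
        (z₃ (+ m) (x₀ y) (x₁ y) (x₂ y) (x₃ y) (x₀ q) (x₁ q) (x₂ q) (x₃ q))
        where
        z₀ : ∀ m a b c d a′ b′ c′ d′ →
          (a + m * a′) * a + (b + m * b′) * b + (c + m * c′) * c + (d + m * d′) * d
          ≡ a * a + b * b + c * c + d * d + m * (a′ * a + b′ * b + c′ * c + d′ * d)
        z₀ = solve-∀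
        z₁ : ∀ m a b c d a′ b′ c′ d′ →
          (b + m * b′) * a - (a + m * a′) * b + (d + m * d′) * c - (c + m * c′) * d
          ≡ m * (0ℤ + (b′ * a - a′ * b + d′ * c - c′ * d))
        z₁ = solve-∀
        z₂ : ∀ m a b c d a′ b′ c′ d′ →
          (c + m * c′) * a - (a + m * a′) * c + (b + m * b′) * d - (d + m * d′) * b
          ≡ m * (0ℤ + (c′ * a - a′ * c + b′ * d - d′ * b))
        z₂ = solve-∀
        z₃ : ∀ m a b c d a′ b′ c′ d′ →
          (d + m * d′) * a - (a + m * a′) * d + (c + m * c′) * b - (b + m * b′) * c
          ≡ m * (0ℤ + (d′ * a - a′ * d + c′ * b - b′ * c))
        z₃ = solve-∀

      norm-w : norm w ≡ r * + p
      norm-w = ℤ.*-cancelˡ-≡ (+ m) (norm w) (r * + p) (ℤ.*-cancelˡ-≡ (+ m) (+ m * norm w) (+ m * (r * + p)) (begin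
        + m * (+ m * norm w)                        ≡⟨ sym (ℤ.*-assoc (+ m) (+ m) (norm w)) ⟩
        + m * + m * norm w                          ≡⟨ sym (norm-• (+ m) w) ⟩
        norm (+ m • w)                              ≡⟨ cong norm (sym x⊛y) ⟩
        norm (zipQ _+_ y (+ m • q) ⊛ y)             ≡⟨ norm-⊛ (zipQ _+_ y (+ m • q)) y ⟩
        norm (zipQ _+_ y (+ m • q)) * norm y        ≡⟨ cong₂ _*_ norm-x norm-y ⟩
        + m * + p * (+ m * r)                       ≡⟨ regroup (+ m) (+ p) r ⟩
        + m * (+ m * (r * + p))                     ∎))
        where
        open ≡-Reasoning
        regroup : ∀ m p r → m * p * (m * r) ≡ m * (m * (r * p))
        regroup = solve-∀

      smaller : ∃[ k ] (0 ℕ.< k × k ℕ.< m × FourSquares (k ℕ.* p))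
      smaller = ∣ r ∣ , ℕ.n≢0⇒n>0 (r≢0 ∘ ℤ.∣i∣≡0⇒i≡0) , ℤ.drop‿+<+ (subst (_< + m) (sym +∣r∣) (ℤ.≤∧≢⇒< r≤m r≢m))
        , w , trans norm-w (trans (cong (_* + p) (sym +∣r∣)) (sym (ℤ.pos-* ∣ r ∣ p)))
        where
        +∣r∣ : + ∣ r ∣ ≡ r
        +∣r∣ = ℤ.0≤i⇒+∣i∣≡i 0≤r

    step : ∀ m → 1 ℕ.< m → m ℕ.< p → FourSquares (m ℕ.* p) → ∃[ k ] (0 ℕ.< k × k ℕ.< m × FourSquares (k ℕ.* p))
    step m 1<m m<p (⟨ a , b , c , d ⟩ , norm-x) =
      let instance
            m≢0 : ℕ.NonZero m
            m≢0 = ℕ.>-nonZero (ℕ.<-trans (s≤s z≤n) 1<m)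
          y₀ , q₀ , a≡ , s₀ = leastResidue m a
          y₁ , q₁ , b≡ , s₁ = leastResidue m b
          y₂ , q₂ , c≡ , s₂ = leastResidue m c
          y₃ , q₃ , d≡ , s₃ = leastResidue m d
      in Step.smaller m 1<m m<p ⟨ y₀ , y₁ , y₂ , y₃ ⟩ ⟨ q₀ , q₁ , q₂ , q₃ ⟩
           (bound y₀ s₀) (bound y₁ s₁) (bound y₂ s₂) (bound y₃ s₃)
           (trans (cong norm (quad≡ (sym a≡) (sym b≡) (sym c≡) (sym d≡))) (trans norm-x (ℤ.pos-* m p)))
      where
      bound : ∀ i → 2 ℕ.* ∣ i ∣ ℕ.≤ m → + 4 * (i * i) ≤ + m * + m
      bound i 2i≤m = subst₂ _≤_ (sym (double-square i)) (ℤ.pos-* m m) (+≤+ (ℕ.*-mono-≤ 2i≤m 2i≤m))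

    descent : ∀ m → 0 ℕ.< m → m ℕ.< p → FourSquares (m ℕ.* p) → FourSquares p
    descent = <-rec (λ m → 0 ℕ.< m → m ℕ.< p → FourSquares (m ℕ.* p) → FourSquares p) λ where
      1 _ _ _ sq → subst FourSquares (ℕ.+-identityʳ p) sq
      m@(suc (suc _)) rec _ m<p sq →
        let k , 0<k , k<m , sq′ = step m (s≤s (s≤s z≤n)) m<p sq
        in rec k<m 0<k (ℕ.<-trans k<m m<p) sq′

    small-multiple : ∀ {k} → p ℕ.∣ k → k ℕ.< p → k ≡ 0
    small-multiple {zero} _ _ = refl
    small-multiple {suc k} p∣k k<p = contradiction (ℕ.∣⇒≤ p∣k) (ℕ.<⇒≱ k<p)

    congruent : ∀ i j → i mod p ≡ j mod p → ∃[ k ] + i - + j ≡ k * + p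
    congruent i j eq = + (i / p) - + (j / p) , (begin
      + i - + j                                                            ≡⟨ cong₂ _-_ (split i) (split j) ⟩
      + (i % p) + + (i / p) * + p - (+ (j % p) + + (j / p) * + p)         
            ≡⟨ cong (λ r → + r + + (i / p) * + p - (+ (j % p) + + (j / p) * + p)) same ⟩
      + (j % p) + + (i / p) * + p - (+ (j % p) + + (j / p) * + p)         
            ≡⟨ cancel (+ (j % p)) (+ (i / p)) (+ (j / p)) (+ p) ⟩
      (+ (i / p) - + (j / p)) * + p                                        ∎)
      where
      open ≡-Reasoning
      split : ∀ i → + i ≡ + (i % p) + + (i / p) * + p
      split i = trans (cong +_ (m≡m%n+[m/n]*n i p)) (cong (λ s → + (i % p) + s) (ℤ.pos-* (i / p) p))
      same : i % p ≡ j % p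
      same = trans (sym (Fin.toℕ-fromℕ< (m%n<n i p))) (trans (cong toℕ eq) (Fin.toℕ-fromℕ< (m%n<n j p)))
      cancel : ∀ r s t p → r + s * p - (r + t * p) ≡ (s - t) * p
      cancel = solve-∀

    -- A small multiple of an odd prime as a sum of four squares

    module Odd (h : ℕ) (p≡ : p ≡ suc (2 ℕ.* h)) where

      h<p : h ℕ.< p
      h<p = subst (h ℕ.<_) (sym p≡) (s≤s (ℕ.m≤m+n h (h ℕ.+ 0)))

      -- p divides (b + t)² - b² = t (2b + t), and both factors are below p since 2b + t ≤ 2h.
      squares-distinct′ : ∀ b t → b ℕ.+ t ℕ.≤ h → (∃[ k ] + (b ℕ.+ t) * + (b ℕ.+ t) - + b * + b ≡ k * + p) → t ≡ 0
      squares-distinct′ b t b+t≤h (k , eq) = [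
            (λ p∣t → small-multiple p∣t (ℕ.≤-<-trans (ℕ.≤-trans (ℕ.m≤n+m t b) b+t≤h) h<p))
        , (λ p∣s → ℕ.m+n≡0⇒n≡0 (b ℕ.+ b)
              (small-multiple p∣s (subst (b ℕ.+ b ℕ.+ t ℕ.<_) (sym p≡) (s≤s bound)))) ]′
        (euclidsLemma t (b ℕ.+ b ℕ.+ t) p-prime (ℕ.divides ∣ k ∣ (trans (cong ∣_∣ product≡) (ℤ.abs-* k (+ p)))))
        where
        product≡ : + (t ℕ.* (b ℕ.+ b ℕ.+ t)) ≡ k * + p
        product≡ = trans (ℤ.pos-* t (b ℕ.+ b ℕ.+ t)) (trans (factor (+ b) (+ t)) eq)
          where
          factor : ∀ b t → t * (b + b + t) ≡ (b + t) * (b + t) - b * b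
          factor = solve-∀
        bound : b ℕ.+ b ℕ.+ t ℕ.≤ 2 ℕ.* h
        bound = ℕ.≤-trans (ℕ.≤-reflexive (ℕ.+-assoc b b t)) (ℕ.+-mono-≤ (ℕ.≤-trans (ℕ.m≤m+n b t) b+t≤h)
          (ℕ.≤-trans b+t≤h (ℕ.≤-reflexive (sym (ℕ.+-identityʳ h)))))

      squares-distinct : ∀ {a b} → a ℕ.≤ h → b ℕ.≤ h → (∃[ k ] + a * + a - + b * + b ≡ k * + p) → a ≡ b
      squares-distinct {a} {b} a≤h b≤h (k , eq) with ℕ.≤-total b a
      ... | inj₁ b≤a = trans (sym a≡) (trans (cong (b ℕ.+_) (squares-distinct′ b (a ℕ.∸ b)
              (subst (ℕ._≤ h) (sym a≡) a≤h) (k , trans (cong (λ s → + s * + s - + b * + b) a≡) eq)))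
                    (ℕ.+-identityʳ b))
        where
        a≡ : b ℕ.+ (a ℕ.∸ b) ≡ a
        a≡ = ℕ.m+[n∸m]≡n b≤a
      ... | inj₂ a≤b = trans (sym (trans (cong (a ℕ.+_) (squares-distinct′ a (b ℕ.∸ a)
              (subst (ℕ._≤ h) (sym b≡) b≤h)
              (- k , trans (cong (λ s → + s * + s - + a * + a) b≡)
                    (trans (flip (+ a * + a) (+ b * + b)) (trans (cong -_ eq) (ℤ.neg-distribˡ-* k (+ p)))))))
              (ℕ.+-identityʳ a))) b≡
        where
        b≡ : a ℕ.+ (b ℕ.∸ a) ≡ b
        b≡ = ℕ.m+[n∸m]≡n a≤b
        flip : ∀ x y → y - x ≡ - (x - y)
        flip = solve-∀

      -- Since 2h ≡ -1 mod p, the two families are the squares and the numbers -(b² + 1).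
      residueOf : Fin (suc h) ⊎ Fin (suc h) → ℕ
      residueOf (inj₁ a) = toℕ a ℕ.* toℕ a
      residueOf (inj₂ b) = 2 ℕ.* h ℕ.* (toℕ b ℕ.* toℕ b ℕ.+ 1)

      residueOf₂ : ∀ b → + residueOf (inj₂ b) ≡ (+ p - 1ℤ) * (+ toℕ b * + toℕ b + 1ℤ)
      residueOf₂ b = trans (ℤ.pos-* (2 ℕ.* h) (toℕ b ℕ.* toℕ b ℕ.+ 1))
        (cong₂ _*_ 2h≡ (cong (_+ 1ℤ) (ℤ.pos-* (toℕ b) (toℕ b))))
        where
        2h≡ : + (2 ℕ.* h) ≡ + p - 1ℤ
        2h≡ = trans (cancel (+ (2 ℕ.* h))) (cong (λ s → + s - 1ℤ) (sym p≡))
          where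
          cancel : ∀ s → s ≡ 1ℤ + s - 1ℤ
          cancel = solve-∀

      -- A collision a² ≡ -(b² + 1) makes a² + b² + 1 + 0 a multiple m p. It is at most 2h² + 1 <
      -- p², so m < p and the descent can start.
      multiple-exists : (a b : Fin (suc h)) → residueOf (inj₁ a) mod p ≡ residueOf (inj₂ b) mod p →
        ∃[ m ] (0 ℕ.< m × m ℕ.< p × FourSquares (m ℕ.* p))
      multiple-exists a b eq =
        ∣ m ∣ , ℕ.n≢0⇒n>0 m≢0 , m<p , x , trans norm-x (trans (cong (_* + p) (sym +∣m∣)) (sym (ℤ.pos-* ∣ m ∣ p)))
        where
        i = toℕ a
        j = toℕ b
        k = proj₁ (congruent (residueOf (inj₁ a)) (residueOf (inj₂ b)) eq)
        m = k + (+ j * + j + 1ℤ)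
        x = ⟨ + i , + j , 1ℤ , 0ℤ ⟩
        norm-x : norm x ≡ m * + p
        norm-x = trans (complete (+ i) (+ j) (+ p)) (trans (cong (λ s → s + (+ j * + j + 1ℤ) * + p)
          (trans (cong₂ _-_ (sym (ℤ.pos-* i i)) (sym (residueOf₂ b)))
            (proj₂ (congruent (residueOf (inj₁ a)) (residueOf (inj₂ b)) eq))))
          (sym (ℤ.*-distribʳ-+ (+ p) k (+ j * + j + 1ℤ))))
          where
          complete : ∀ i j p → i * i + j * j + 1ℤ * 1ℤ + 0ℤ * 0ℤ
            ≡ i * i - (p - 1ℤ) * (j * j + 1ℤ) + (j * j + 1ℤ) * p
          complete = solve-∀
        norm-x≡ : norm x ≡ + (i ℕ.* i ℕ.+ j ℕ.* j ℕ.+ 1)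
        norm-x≡ = trans (cong₂ (λ s t → s + t + 1ℤ * 1ℤ + 0ℤ * 0ℤ) (sym (ℤ.pos-* i i)) (sym (ℤ.pos-* j j)))
              (ℤ.+-identityʳ _)
        0≤m : 0ℤ ≤ m
        0≤m = ℤ.*-cancelʳ-≤-pos 0ℤ m (+ p) {{positive (+<+ (ℕ.>-nonZero⁻¹ p))}} (subst (0ℤ ≤_) norm-x (norm≥0 x))
        +∣m∣ : + ∣ m ∣ ≡ m
        +∣m∣ = ℤ.0≤i⇒+∣i∣≡i 0≤m
        sum≡ : i ℕ.* i ℕ.+ j ℕ.* j ℕ.+ 1 ≡ ∣ m ∣ ℕ.* p
        sum≡ = ℤ.+-injective (trans (sym norm-x≡)
              (trans norm-x (trans (cong (_* + p) (sym +∣m∣)) (sym (ℤ.pos-* ∣ m ∣ p)))))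
        m≢0 : ∣ m ∣ ≢ 0
        m≢0 m≡0 = case trans (ℕ.+-comm 1 (i ℕ.* i ℕ.+ j ℕ.* j)) (trans sum≡ (cong (ℕ._* p) m≡0)) of λ ()
        i≤h : i ℕ.≤ h
        i≤h = ℕ.s≤s⁻¹ (Fin.toℕ<n a)
        j≤h : j ℕ.≤ h
        j≤h = ℕ.s≤s⁻¹ (Fin.toℕ<n b)
        m<p : ∣ m ∣ ℕ.< p
        m<p = ℕ.*-cancelʳ-< p ∣ m ∣ p (begin-strict
          ∣ m ∣ ℕ.* p                       ≡⟨ sym sum≡ ⟩
          i ℕ.* i ℕ.+ j ℕ.* j ℕ.+ 1         ≤⟨ ℕ.+-monoˡ-≤ 1
                (ℕ.+-mono-≤ (ℕ.*-mono-≤ i≤h i≤h) (ℕ.*-mono-≤ j≤h j≤h)) ⟩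
          h ℕ.* h ℕ.+ h ℕ.* h ℕ.+ 1         ≡⟨ cong (λ s → h ℕ.* h ℕ.+ s ℕ.+ 1) (sym (ℕ.+-identityʳ (h ℕ.* h))) ⟩
          2 ℕ.* (h ℕ.* h) ℕ.+ 1             ≡⟨ ℕ.+-comm (2 ℕ.* (h ℕ.* h)) 1 ⟩
          suc (2 ℕ.* (h ℕ.* h))             ≡⟨ cong suc (sym (ℕ.*-assoc 2 h h)) ⟩
          suc (2 ℕ.* h ℕ.* h)              
                <⟨ s≤s (ℕ.≤-<-trans (ℕ.*-monoʳ-≤ (2 ℕ.* h) (ℕ.<⇒≤ h<p))
                      (ℕ.m<n+m (2 ℕ.* h ℕ.* p) {p ℕ.∸ 1}
                            (ℕ.m<n⇒0<n∸m (ℕ.nonTrivial⇒n>1 p {{prime⇒nonTrivial p-prime}})))) ⟩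
          suc (p ℕ.∸ 1 ℕ.+ 2 ℕ.* h ℕ.* p)   ≡⟨ cong (ℕ._+ 2 ℕ.* h ℕ.* p) (ℕ.suc-pred p) ⟩
          p ℕ.+ 2 ℕ.* h ℕ.* p               ≡⟨ cong (ℕ._* p) (sym p≡) ⟩
          p ℕ.* p                           ∎)
          where open ℕ.≤-Reasoning

      -- The two families have p + 1 members altogether, so two of them agree modulo p. Within a
      -- family the residues are distinct, hence the collision is between a square and some -(b² +
      -- 1).
      fourSquares : FourSquares p
      fourSquares with Fin.pigeonhole p<2h+2 (λ i → residueOf (splitAt (suc h) i) mod p)
        where
        p<2h+2 : p ℕ.< suc h ℕ.+ suc h
        p<2h+2 = ℕ.≤-reflexive (cong suc
              (trans p≡ (trans (cong (λ s → suc (h ℕ.+ s)) (ℕ.+-identityʳ h)) (sym (ℕ.+-suc h h)))))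
      ... | i , j , i<j , eq = collision (splitAt (suc h) i) (splitAt (suc h) j) refl refl eq
        where
        i≢j : i ≢ j
        i≢j i≡j = ℕ.<-irrefl (cong toℕ i≡j) i<j
        unsplit : splitAt (suc h) i ≡ splitAt (suc h) j → ⊥
        unsplit same = i≢j (trans (sym (Fin.join-splitAt (suc h) (suc h) i))
          (trans (cong (join (suc h) (suc h)) same) (Fin.join-splitAt (suc h) (suc h) j)))
        same-squares : ∀ a b → (∃[ k ] + toℕ a * + toℕ a - + toℕ b * + toℕ b ≡ k * + p) → a ≡ b
        same-squares a b sq = Fin.toℕ-injective
              (squares-distinct (ℕ.s≤s⁻¹ (Fin.toℕ<n a)) (ℕ.s≤s⁻¹ (Fin.toℕ<n b)) sq)
        found : (∃[ m ] (0 ℕ.< m × m ℕ.< p × FourSquares (m ℕ.* p))) → FourSquares p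
        found (m , 0<m , m<p , sq) = descent m 0<m m<p sq
        collision : ∀ s t → splitAt (suc h) i ≡ s → splitAt (suc h) j ≡ t → residueOf s mod p
              ≡ residueOf t mod p → FourSquares p
        collision (inj₁ a) (inj₂ b) _ _ eq = found (multiple-exists a b eq)
        collision (inj₂ b) (inj₁ a) _ _ eq = found (multiple-exists a b (sym eq))
        collision (inj₁ a) (inj₁ b) s t eq = ⊥-elim (unsplit (trans s (trans (cong inj₁ (same-squares a b
          (let k , eq′ = congruent (residueOf (inj₁ a)) (residueOf (inj₁ b)) eq
           in k , trans (cong₂ _-_ (sym (ℤ.pos-* (toℕ a) (toℕ a))) (sym (ℤ.pos-* (toℕ b) (toℕ b)))) eq′)))
                     (sym t))))
        collision (inj₂ a) (inj₂ b) s t eq = ⊥-elim (unsplit (trans s (trans (cong inj₂ (same-squares a b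
          (let k , eq′ = congruent (residueOf (inj₂ a)) (residueOf (inj₂ b)) eq
           in (+ toℕ a * + toℕ a - + toℕ b * + toℕ b) - k
            , trans (complete (+ p) (+ toℕ a * + toℕ a) (+ toℕ b * + toℕ b))
                (trans (cong (λ s → (+ toℕ a * + toℕ a - + toℕ b * + toℕ b) * + p - s)
                  (trans (cong₂ _-_ (sym (residueOf₂ a)) (sym (residueOf₂ b))) eq′))
                  (factor (+ toℕ a * + toℕ a - + toℕ b * + toℕ b) k (+ p)))))) (sym t))))
          where
          complete : ∀ p x y → x - y ≡ (x - y) * p - ((p - 1ℤ) * (x + 1ℤ) - (p - 1ℤ) * (y + 1ℤ))
          complete = solve-∀
          factor : ∀ d k p → d * p - k * p ≡ (d - k) * p
          factor = solve-∀

  prime-fourSquares : ∀ {p} → Prime p → FourSquares p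
  prime-fourSquares {p} p-prime with 2 ℕ.∣? p
  ... | yes 2∣p = case prime⇒irreducible p-prime 2∣p of λ where
        (inj₂ refl) → ⟨ 1ℤ , 1ℤ , 0ℤ , 0ℤ ⟩ , refl
  ... | no 2∤p = Descent.Odd.fourSquares p p-prime (p / 2) odd
    where
    odd : p ≡ suc (2 ℕ.* (p / 2))
    odd with p % 2 | m%n<n p 2 | m≡m%n+[m/n]*n p 2
    ... | 0 | _ | eq = contradiction (ℕ.divides (p / 2) eq) 2∤p
    ... | 1 | _ | eq = trans eq (cong suc (ℕ.*-comm (p / 2) 2))
    ... | suc (suc _) | s≤s (s≤s ()) | _

  lagrange : ∀ n → FourSquares n
  lagrange zero = ⟨ 0ℤ , 0ℤ , 0ℤ , 0ℤ ⟩ , refl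
  lagrange n@(suc _) = subst FourSquares (sym (PrimeFactorisation.isFactorisation f))
        (all (PrimeFactorisation.factorsPrime f))
    where
    f = factorise n
    all : ∀ {ps} → All Prime ps → FourSquares (product ps)
    all [] = ⟨ 1ℤ , 0ℤ , 0ℤ , 0ℤ ⟩ , refl
    all {p ∷ ps} (p-prime ∷ ps-prime) = fourSquares-* {p} {product ps} (prime-fourSquares p-prime) (all ps-prime)

open import Data.Nat using (ℕ; _*_; _≤_; _≥_)
open import Data.List using (List; length)
open import Data.List.Relation.Unary.All using (All)
open import Data.Product using (Σ-syntax; _×_; _,_)
open import Relation.Binary.PropositionalEquality using (_≡_)

theorem2p1 : (ρ : ℕ) → 1 ≤ ρ → (n : ℕ) → n ≥ 550 * (ρ * ρ) →
    Σ[ xs ∈ List ℕ ] (length xs ≤ 4 × All (S ρ) xs × n ≡ sumSq xs)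
theorem2p1 ρ 1≤ρ n n-large =
  let x , norm-x = Proof.lagrange n
  in Proof.Finish.fromAny ρ n 1≤ρ n-large x norm-x
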